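{- The problem \textsc{Vertex Cover above $h$-Index} is fixed-parameter tractable: there is a computable function $f$ and an algorithm that, given a graph $G$ and an integer $k$, decides whether $G$ has a vertex cover of size at most $k$ in time $f(\ell)\cdot |I|^{O(1)}$, where $\ell = k - h(G)$ and $|I|$ is the size of the input.
   Context: All graphs are finite, undirected and loopless. A vertex cover of $G$ is a set $X\subseteq V(G)$ such that every edge has at least one endpoint in $X$. The $h$-index $h(G)$ of a graph $G$ is the largest integer $k$ such that $G$ contains at least $k$ vertices each of degree at least $k$. A parameterized problem is fixed-parameter tractable (FPT) with respect to a parameter $\ell$ if it can be decided in time $f(\ell)\cdot|I|^{c}$ for a computable function $f$ and a constant $c$. -}

module Defs where

open import Data.Bool.Base using (Bool; true; false)
open import Data.Fin.Base using (Fin; zero)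
open import Data.Fin.Subset using (Subset; _∈_; ∣_∣)
open import Data.Fin.Subset.Properties using (∣p∣≤n)
open import Data.Integer.Base as ℤ using (ℤ; +_; -[1+_])
open import Data.List.Base as List using (List; []; _∷_; upTo; filter)
open import Data.List.Extrema.Nat using (max; xs≤max; argmax-all)
open import Data.List.Membership.Propositional.Properties using (∈-filter⁺; ∈-filter⁻; ∈-upTo⁺)
import Data.List.Relation.Unary.All as All
open import Data.Nat.Base using (ℕ; zero; suc; _+_; _*_; _^_; _≤_; _≤ᵇ_; z≤n; s≤s)
open import Data.Nat.Binary.Base as ℕᵇ using (ℕᵇ; 2[1+_]; 1+[2_])
open import Data.Nat.Properties using (_≤?_; ≤-trans)
open import Data.Product.Base using (Σ; ∃-syntax; _×_; _,_; proj₂)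
open import Data.Sum.Base using (_⊎_)
open import Data.Vec.Base as Vec using (Vec; lookup; tabulate; _[_]≔_; replicate)
open import Function.Base using (id)
open import Relation.Binary.PropositionalEquality.Core using (_≡_; refl; trans; sym)
open import Relation.Nullary.Reflects using (Reflects)

record Graph : Set where
  field
    order      : ℕ
    adjacent   : Fin order → Fin order → Bool
    undirected : ∀ u v → adjacent u v ≡ adjacent v u
    loopless   : ∀ v → adjacent v v ≡ false

  Vertex : Set
  Vertex = Fin order

open Graph public using (order; adjacent; Vertex)

IsVertexCover : (G : Graph) → Subset (order G) → Set
IsVertexCover G X = ∀ u v → adjacent G u v ≡ true → u ∈ X ⊎ v ∈ X

HasVertexCoverOfSize≤ : Graph → ℤ → Set
HasVertexCoverOfSize≤ G k = ∃[ X ] IsVertexCover G X × + ∣ X ∣ ℤ.≤ k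

-- A `Subset n` is a vector of Booleans, so a Boolean-valued function on
-- vertices tabulates to the set of vertices on which it is true.

neighbours : (G : Graph) → Vertex G → Subset (order G)
neighbours G v = tabulate (adjacent G v)

degree : (G : Graph) → Vertex G → ℕ
degree G v = ∣ neighbours G v ∣

verticesOfDegree≥ : (G : Graph) → ℕ → Subset (order G)
verticesOfDegree≥ G k = tabulate λ v → k ≤ᵇ degree G v

AtLeast_VerticesOfDegree≥Itself : ℕ → Graph → Set
AtLeast_VerticesOfDegree≥Itself k G = k ≤ ∣ verticesOfDegree≥ G k ∣

-- Candidates larger than the order of the graph can never qualify; that
-- this is the largest integer overall is `hIndex-maximal`.

hIndex : Graph → ℕ
hIndex G = max 0 (filter (λ k → k ≤? ∣ verticesOfDegree≥ G k ∣) (upTo (suc (order G))))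

hIndex-attained : ∀ G → AtLeast hIndex G VerticesOfDegree≥Itself G
hIndex-attained G =
  argmax-all id {P = λ k → AtLeast k VerticesOfDegree≥Itself G} z≤n
    (All.tabulate λ k∈ →
      proj₂ (∈-filter⁻ (λ k → k ≤? ∣ verticesOfDegree≥ G k ∣)
                       {xs = upTo (suc (order G))} k∈))

hIndex-maximal : ∀ G k → AtLeast k VerticesOfDegree≥Itself G → k ≤ hIndex G
hIndex-maximal G k p =
  All.lookup (xs≤max 0 _)
    (∈-filter⁺ (λ k → k ≤? ∣ verticesOfDegree≥ G k ∣)
      (∈-upTo⁺ (s≤s (≤-trans p (∣p∣≤n (verticesOfDegree≥ G k))))) p)

-- Model of computation: Jones's WHILE language (N. D. Jones,
-- "Computability and Complexity from a Programming Perspective").  A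
-- program has finitely many variables holding binary trees.  Every
-- operation has unit cost; since trees are only inspected by testing for
-- nil, they can be kept as shared pointer structures, and this time
-- measure is polynomially related to that of Turing machines.

data Tree : Set where
  nil  : Tree
  cons : Tree → Tree → Tree

size : Tree → ℕ
size nil        = 1
size (cons s t) = suc (size s + size t)

head : Tree → Tree
head nil        = nil
head (cons s t) = s

tail : Tree → Tree
tail nil        = nil
tail (cons s t) = t

data Expr (m : ℕ) : Set where
  var     : Fin m → Expr m
  `nil    : Expr m
  `cons   : Expr m → Expr m → Expr m
  `head   : Expr m → Expr m
  `tail   : Expr m → Expr m

infix  6 _:=_
infixr 5 _⨾_

data Cmd (m : ℕ) : Set where
  _:=_          : Fin m → Expr m → Cmd m
  _⨾_           : Cmd m → Cmd m → Cmd m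
  if_then_else_ : Expr m → Cmd m → Cmd m → Cmd m
  while_loop_   : Expr m → Cmd m → Cmd m

Store : ℕ → Set
Store m = Vec Tree m

⟦_⟧ : ∀ {m} → Expr m → Store m → Tree
⟦ var x ⟧     σ = lookup σ x
⟦ `nil ⟧      σ = nil
⟦ `cons d e ⟧ σ = cons (⟦ d ⟧ σ) (⟦ e ⟧ σ)
⟦ `head e ⟧   σ = head (⟦ e ⟧ σ)
⟦ `tail e ⟧   σ = tail (⟦ e ⟧ σ)

cost : ∀ {m} → Expr m → ℕ
cost (var x)     = 1
cost `nil        = 1
cost (`cons d e) = suc (cost d + cost e)
cost (`head e)   = suc (cost e)
cost (`tail e)   = suc (cost e)

-- `c , σ ⇓ τ , t`: started in σ, the command c halts in τ after t steps.
-- In tests, nil is false and every other tree is true.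

infix 4 _,_⇓_,_

data _,_⇓_,_ {m : ℕ} : Cmd m → Store m → Store m → ℕ → Set where
  assign      : ∀ {x e σ} →
                x := e , σ ⇓ σ [ x ]≔ ⟦ e ⟧ σ , suc (cost e)
  seq         : ∀ {c d σ τ υ s t} →
                c , σ ⇓ τ , s → d , τ ⇓ υ , t →
                c ⨾ d , σ ⇓ υ , s + t
  if-true     : ∀ {e c d σ τ t a b} → ⟦ e ⟧ σ ≡ cons a b →
                c , σ ⇓ τ , t →
                if e then c else d , σ ⇓ τ , suc (cost e) + t
  if-false    : ∀ {e c d σ τ t} → ⟦ e ⟧ σ ≡ nil →
                d , σ ⇓ τ , t →
                if e then c else d , σ ⇓ τ , suc (cost e) + t
  while-true  : ∀ {e c σ τ υ s t a b} → ⟦ e ⟧ σ ≡ cons a b →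
                c , σ ⇓ τ , s → while e loop c , τ ⇓ υ , t →
                while e loop c , σ ⇓ υ , suc (cost e) + (s + t)
  while-false : ∀ {e c σ} → ⟦ e ⟧ σ ≡ nil →
                while e loop c , σ ⇓ σ , suc (cost e)

private
  nil≢cons : ∀ {ℓ} {A : Set ℓ} {s a b} → s ≡ cons a b → s ≡ nil → A
  nil≢cons p q with trans (sym p) q
  ... | ()

⇓-deterministic : ∀ {m} {c : Cmd m} {σ τ τ′ t t′} →
                  c , σ ⇓ τ , t → c , σ ⇓ τ′ , t′ → τ ≡ τ′ × t ≡ t′
⇓-deterministic assign assign = refl , refl
⇓-deterministic (seq p q) (seq p′ q′) with ⇓-deterministic p p′
... | refl , refl with ⇓-deterministic q q′
... | refl , refl = refl , refl
⇓-deterministic (if-true _ p) (if-true _ p′) with ⇓-deterministic p p′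
... | refl , refl = refl , refl
⇓-deterministic (if-true e _) (if-false e′ _) = nil≢cons e e′
⇓-deterministic (if-false e _) (if-true e′ _) = nil≢cons e′ e
⇓-deterministic (if-false _ p) (if-false _ p′) with ⇓-deterministic p p′
... | refl , refl = refl , refl
⇓-deterministic (while-true _ p q) (while-true _ p′ q′) with ⇓-deterministic p p′
... | refl , refl with ⇓-deterministic q q′
... | refl , refl = refl , refl
⇓-deterministic (while-true e _ _) (while-false e′) = nil≢cons e e′
⇓-deterministic (while-false e) (while-true e′ _ _) = nil≢cons e′ e
⇓-deterministic (while-false _) (while-false _) = refl , refl

-- Variable `zero` holds the input at the start and the output at the end;
-- all other variables start as nil.

record Program : Set where
  constructor program
  field
    {auxiliary} : ℕ
    body        : Cmd (suc auxiliary)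

_on_outputs_inTime_ : Program → Tree → Tree → ℕ → Set
program {m} c on i outputs o inTime t =
  ∃[ τ ] (c , i Vec.∷ replicate m nil ⇓ τ , t) × lookup τ zero ≡ o

encodeBool : Bool → Tree
encodeBool false = nil
encodeBool true  = cons nil nil

encodeList : {A : Set} → (A → Tree) → List A → Tree
encodeList encode []       = nil
encodeList encode (x ∷ xs) = cons (encode x) (encodeList encode xs)

-- Numbers are written in (bijective) binary, least significant digit first.

encodeℕᵇ : ℕᵇ → Tree
encodeℕᵇ ℕᵇ.zero  = nil
encodeℕᵇ 2[1+ n ] = cons (encodeBool true) (encodeℕᵇ n)
encodeℕᵇ 1+[2 n ] = cons (encodeBool false) (encodeℕᵇ n)

encodeℕ : ℕ → Tree
encodeℕ n = encodeℕᵇ (ℕᵇ.fromℕ n)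

encodeℤ : ℤ → Tree
encodeℤ (+ n)    = cons (encodeBool false) (encodeℕ n)
encodeℤ -[1+ n ] = cons (encodeBool true) (encodeℕ n)

encodeGraph : Graph → Tree
encodeGraph G =
  encodeList (encodeList encodeBool)
    (List.tabulate λ u → List.tabulate λ v → adjacent G u v)

Computable : (ℤ → ℕ) → Set
Computable f =
  Σ Program λ p → ∀ z → ∃[ t ] p on encodeℤ z outputs encodeℕ (f z) inTime t

-- The parameter is integer-valued, as it may be a difference.

record ParameterizedProblem : Set₁ where
  field
    Instance  : Set
    encode    : Instance → Tree
    Yes       : Instance → Set
    parameter : Instance → ℤ

_decides_within_ : Program → (Π : ParameterizedProblem) →
                   (ParameterizedProblem.Instance Π → ℕ) → Set
p decides Π within bound =
  ∀ I → ∃[ b ] ∃[ t ] p on encode I outputs encodeBool b inTime t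
                    × Reflects (Yes I) b
                    × t ≤ bound I
  where open ParameterizedProblem Π

FixedParameterTractable : ParameterizedProblem → Set
FixedParameterTractable Π =
  Σ (ℤ → ℕ) λ f → Computable f ×
  Σ Program λ p → Σ ℕ λ c →
  p decides Π within λ I → f (parameter I) * size (encode I) ^ c
  where open ParameterizedProblem Π

VertexCoverAboveHIndex : ParameterizedProblem
VertexCoverAboveHIndex = record
  { Instance  = Graph × ℤ
  ; encode    = λ (G , k) → cons (encodeGraph G) (encodeℤ k)
  ; Yes       = λ (G , k) → HasVertexCoverOfSize≤ G k
  ; parameter = λ (G , k) → k ℤ.- + hIndex G
  }

{-# OPTIONS --safe #-}

-- Let h be the h-index and H the set of at least h vertices of degree at
-- least h.  A vertex cover X either contains H, or misses some v in H and then
-- contains the at least h neighbours of v.  Starting from each of these at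
-- most n + 1 sets, only ℓ = k - h further vertices may be chosen, and a
-- bounded search tree does the rest.  The tree is explored breadth first: a
-- list of candidates (S, b) with |S| + b = k is swept once per vertex v, and
-- a candidate with neither v ∈ S nor N(v) ⊆ S is replaced by its extensions
-- by v and by N(v).  Both cost budget, so the sum of 2 ^ b over the list does
-- not increase, and the list never has more than (n + 1) 2 ^ ℓ entries.

module Submission where

open import Defs

open import Data.Bool.Base as Bool using (Bool; true; false; not)
open import Data.Fin.Base using (Fin; zero)
open import Data.Fin.Properties using (any?)
open import Data.Fin.Subset using (Subset; ⊥; ⁅_⁆; _∈_; _⊆_; _∪_; ∣_∣)
open import Data.Fin.Subset.Properties using (_∈?_; ∣⊥∣≡0; ∪-identityʳ; p⊆q⇒∣p∣≤∣q∣; p⊂q⇒∣p∣<∣q∣; p⊆p∪q; q⊆p∪q; x∈p∪q⁻; x∈⁅x⁆; x∈⁅y⁆⇒x≡y; ⊥⊆; ∣p∣≤n)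
open import Data.Integer.Base as ℤ using (ℤ; -[1+_]; +≤+)
open import Data.Integer.Properties using (m-n≡m⊖n; ⊖-≥; drop‿+≤+)
open import Data.List.Base as List using (List; []; _∷_; length; reverse; _ʳ++_; replicate; map; foldr; filterᵇ; allFin; tabulate; null)
open import Data.List.Membership.Propositional using (lose)
open import Data.List.Membership.Propositional.Properties using (∈-allFin; ∈-filter⁺; ∈-map⁺)
open import Data.List.Properties using (reverse-involutive; length-reverse; length-replicate; length-map; length-filter; length-tabulate; length-ʳ++; map-tabulate)
open import Data.List.Relation.Unary.All as All using (All; []; _∷_)
import Data.List.Relation.Unary.All.Properties as All
open import Data.List.Relation.Unary.Any using (Any; here; there)
open import Data.List.Relation.Unary.Any.Properties using (¬Any[])
open import Data.Maybe.Base using (Maybe; just; nothing; maybe; is-nothing)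
open import Data.Nat.Base
open import Data.Nat.Binary.Base as ℕᵇ using (ℕᵇ; 2[1+_]; 1+[2_])
open import Data.Nat.Binary.Properties using (toℕ-fromℕ; fromℕ-toℕ)
open import Data.Nat.Properties
open import Data.Nat.Tactic.RingSolver using (solve-∀)
open import Data.Product.Base using (Σ; Σ-syntax; ∃-syntax; _×_; _,_; proj₁; proj₂; map₁)
open import Data.Sum.Base using (_⊎_; inj₁; inj₂; [_,_]′) renaming (map to map-⊎)
open import Data.Unit.Base using (⊤; tt)
open import Data.Vec.Base as Vec using ([]; _∷_; lookup; toList)
open import Data.Vec.Properties using (lookup∘tabulate; tabulate-cong; lookup⇒[]=; []=⇒lookup; toList-replicate; length-toList)
open import Function.Base using (_∘_; id)
open import Relation.Binary.PropositionalEquality using (_≡_; refl; sym; trans; cong; cong₂; subst; subst₂; _≢_)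
open import Relation.Nullary using (¬_; yes; no; contradiction)
open import Relation.Nullary.Decidable using (_×-dec_; ¬?; T?; decidable-stable)
open import Relation.Nullary.Reflects using (Reflects; ofʸ; ofⁿ; det)

-- The WHILE language has loops but no recursion; the breadth-first sweep turns the search tree into
-- nested loops over lists, whose cost is controlled once the list lengths are. Comparisons of sets
-- and sizes are all reduced to one routine, adding a set to another on a budget: with budget 0 it
-- tests inclusion, and started from the empty set with budget `i` it tests for more than `i`
-- elements. Thus h is never computed by itself: thresholds are tried in turn, and the start sets of
-- the largest successful one are kept. For 0 ≤ k < h all start sets exceed the budget and are
-- dropped, so the answer is negative; the width bound holds with the exponent truncated to 0.
-- Written in binary, k may be exponential in the input size, but h ≤ n gives k ≤ n + (k ∸ h), and
-- the part above n is paid for by f(ℓ). Constant factors of running times move into the exponent of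
-- |I|.

infix 4 _,_⇓_within_

_,_⇓_within_ : Cmd 1 → Tree → Tree → ℕ → Set
c , s ⇓ s′ within B = ∃[ t ] (c , s ∷ [] ⇓ s′ ∷ [] , t) × t ≤ B

-- A single variable suffices, since a tree can hold a tuple of values.  The
-- inputs of interest form a family indexed by A, so that A can also carry
-- preconditions; the constant factor keeps T free of constants.

record Realizes {A : Set} (inp out : A → Tree) (T : A → ℕ) : Set where
  field
    cmd    : Cmd 1
    factor : ℕ
    run    : ∀ a → cmd , inp a ⇓ out a within factor * suc (T a)

open Realizes

x₀ : Expr 1
x₀ = var zero

infixr 4 _▸_

private
  variable
    A B : Set
    inp mid out : A → Tree
    T : A → ℕ

reindex : (g : B → A) → Realizes inp out T → Realizes (inp ∘ g) (out ∘ g) (T ∘ g)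
reindex g R .cmd    = R .cmd
reindex g R .factor = R .factor
reindex g R .run    = R .run ∘ g

weaken : ∀ {T U : A → ℕ} → (∀ a → T a ≤ U a) → Realizes inp out T → Realizes inp out U
weaken T≤U R .cmd    = R .cmd
weaken T≤U R .factor = R .factor
weaken T≤U R .run a  =
  let t , r , t≤ = R .run a
  in  t , r , ≤-trans t≤ (*-monoʳ-≤ (R .factor) (s≤s (T≤U a)))

respect : ∀ {inp inp′ out out′ : A → Tree} {T} →
          (∀ a → inp a ≡ inp′ a) → (∀ a → out a ≡ out′ a) →
          Realizes inp out T → Realizes inp′ out′ T
respect i o R .cmd    = R .cmd
respect i o R .factor = R .factor
respect i o R .run a  =
  subst₂ (R .cmd ,_⇓_within R .factor * suc _) (i a) (o a) (R .run a)

-- Both halves share one `T`, so that composition merely adds the factors; the stages of a pipeline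
-- are first weakened to a common bound.
_▸_ : Realizes inp mid T → Realizes mid out T → Realizes inp out T
(R ▸ S) .cmd    = R .cmd ⨾ S .cmd
(R ▸ S) .factor = R .factor + S .factor
_▸_ {T = T} R S .run a =
  let s , r , s≤ = R .run a
      t , q , t≤ = S .run a
  in  s + t , seq r q ,
      ≤-trans (+-mono-≤ s≤ t≤) (≤-reflexive (sym (*-distribʳ-+ (suc (T a)) (R .factor) (S .factor))))

-- Loop-free programs

data Decision : Set where
  return       : Expr 1 → Decision
  test_yes_no_ : Expr 1 → Decision → Decision → Decision

mutual
  decide : Decision → Tree → Tree
  decide (return e)          s = ⟦ e ⟧ (s ∷ [])
  decide (test e yes c no d) s = branch (⟦ e ⟧ (s ∷ [])) c d s

  branch : Tree → Decision → Decision → Tree → Tree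
  branch (cons _ _) c d s = decide c s
  branch nil        c d s = decide d s

decision-cmd : Decision → Cmd 1
decision-cmd (return e)          = zero := e
decision-cmd (test e yes c no d) = if e then decision-cmd c else decision-cmd d

decision-time : Decision → ℕ
decision-time (return e)          = suc (cost e)
decision-time (test e yes c no d) = suc (cost e) + (decision-time c + decision-time d)

decision-run : ∀ d s → decision-cmd d , s ⇓ decide d s within decision-time d
decision-run (return e) s = suc (cost e) , assign , ≤-refl
decision-run (test e yes c no d) s with ⟦ e ⟧ (s ∷ []) in eq
... | cons _ _ =
  let t , r , t≤ = decision-run c s
  in  suc (cost e) + t , if-true eq r , +-monoʳ-≤ (suc (cost e)) (m≤n⇒m≤n+o _ t≤)
... | nil      =
  let t , r , t≤ = decision-run d s
  in  suc (cost e) + t , if-false eq r , +-monoʳ-≤ (suc (cost e)) (m≤n⇒m≤o+n _ t≤)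

-- The running time of loop-free code is bounded by a constant read off its text, hence fits any
-- `T`. Since `decide` computes, the remaining obligation usually closes by `refl` after a case
-- split.
by-decision : (d : Decision) → (∀ a → decide d (inp a) ≡ out a) → Realizes inp out T
by-decision d eq .cmd    = decision-cmd d
by-decision d eq .factor = decision-time d
by-decision {inp = inp} d eq .run a =
  let t , r , t≤ = decision-run d (inp a)
  in  subst (decision-cmd d , inp a ⇓_within _) (eq a) (t , r , m≤n⇒m≤n*o (suc _) t≤)

set : (e : Expr 1) → (∀ a → ⟦ e ⟧ (inp a ∷ []) ≡ out a) → Realizes inp out T
set e = by-decision (return e)

-- Subprograms acting on part of the state, and loops over lists

focusᵉ : Expr 1 → Expr 1
focusᵉ (var _)     = `head x₀
focusᵉ `nil        = `nil
focusᵉ (`cons d e) = `cons (focusᵉ d) (focusᵉ e)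
focusᵉ (`head e)   = `head (focusᵉ e)
focusᵉ (`tail e)   = `tail (focusᵉ e)

-- With a single variable, a program can be reused within a larger state only if it is rewritten to
-- act on the head of a pair; each assignment rebuilds the pair around the untouched tail.
focusᶜ : Cmd 1 → Cmd 1
focusᶜ (_ := e)             = zero := `cons (focusᵉ e) (`tail x₀)
focusᶜ (c ⨾ d)              = focusᶜ c ⨾ focusᶜ d
focusᶜ (if e then c else d) = if focusᵉ e then focusᶜ c else focusᶜ d
focusᶜ (while e loop c)     = while focusᵉ e loop focusᶜ c

framed : Tree → Store 1 → Store 1
framed r σ = cons (lookup σ zero) r ∷ []

focusᵉ-sound : ∀ e r σ → ⟦ focusᵉ e ⟧ (framed r σ) ≡ ⟦ e ⟧ σ
focusᵉ-sound (var zero)  r σ = refl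
focusᵉ-sound `nil        r σ = refl
focusᵉ-sound (`cons d e) r σ = cong₂ cons (focusᵉ-sound d r σ) (focusᵉ-sound e r σ)
focusᵉ-sound (`head e)   r σ = cong head (focusᵉ-sound e r σ)
focusᵉ-sound (`tail e)   r σ = cong tail (focusᵉ-sound e r σ)

-- The factor 4 is dictated by assignments: rebuilding the pair brings the fixed overhead of one
-- from 1 to 4.
focusᵉ-cost : ∀ e → cost (focusᵉ e) ≤ 4 * cost e
focusᵉ-cost (var _)     = s≤s (s≤s z≤n)
focusᵉ-cost `nil        = s≤s z≤n
focusᵉ-cost (`cons d e) = begin
  suc (cost (focusᵉ d) + cost (focusᵉ e)) ≤⟨ s≤s (+-mono-≤ (focusᵉ-cost d) (focusᵉ-cost e)) ⟩
  1 + (4 * cost d + 4 * cost e)           ≤⟨ +-monoˡ-≤ _ (s≤s (z≤n {3})) ⟩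
  4 + (4 * cost d + 4 * cost e)           ≡⟨ shape (cost d) (cost e) ⟩
  4 * suc (cost d + cost e)               ∎
  where
  open ≤-Reasoning
  shape : ∀ d e → 4 + (4 * d + 4 * e) ≡ 4 * suc (d + e)
  shape = solve-∀
focusᵉ-cost (`head e) = ≤-trans (+-mono-≤ (s≤s (z≤n {3})) (focusᵉ-cost e)) (≤-reflexive (sym (*-suc 4 (cost e))))
focusᵉ-cost (`tail e) = ≤-trans (+-mono-≤ (s≤s (z≤n {3})) (focusᵉ-cost e)) (≤-reflexive (sym (*-suc 4 (cost e))))

test-bound : ∀ e {t t′} → t′ ≤ 4 * t → suc (cost (focusᵉ e)) + t′ ≤ 4 * (suc (cost e) + t)
test-bound e {t} {t′} t′≤ = begin
  suc (cost (focusᵉ e)) + t′   ≤⟨ +-mono-≤ (s≤s (focusᵉ-cost e)) t′≤ ⟩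
  1 + 4 * cost e + 4 * t       ≤⟨ +-monoˡ-≤ (4 * t) (+-monoˡ-≤ (4 * cost e) (s≤s (z≤n {3}))) ⟩
  4 + 4 * cost e + 4 * t       ≡⟨ shape (cost e) t ⟩
  4 * (suc (cost e) + t)       ∎
  where
  open ≤-Reasoning
  shape : ∀ c t → 4 + 4 * c + 4 * t ≡ 4 * (suc c + t)
  shape = solve-∀

focusᶜ-run : ∀ {c σ τ t} r → c , σ ⇓ τ , t →
             ∃[ t′ ] (focusᶜ c , framed r σ ⇓ framed r τ , t′) × t′ ≤ 4 * t
focusᶜ-run {σ = s ∷ []} r (assign {x = zero} {e = e}) =
  _ , subst (λ v → _ , _ ⇓ cons v r ∷ [] , _) (focusᵉ-sound e r (s ∷ [])) assign , bound
  where
  open ≤-Reasoning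
  shape : ∀ c → 2 + (c + 2) ≡ 4 + c
  shape = solve-∀
  bound : 2 + (cost (focusᵉ e) + 2) ≤ 4 * suc (cost e)
  bound = begin
    2 + (cost (focusᵉ e) + 2) ≡⟨ shape (cost (focusᵉ e)) ⟩
    4 + cost (focusᵉ e)       ≤⟨ +-monoʳ-≤ 4 (focusᵉ-cost e) ⟩
    4 + 4 * cost e            ≡⟨ *-suc 4 (cost e) ⟨
    4 * suc (cost e)          ∎
focusᶜ-run r (seq {s = s} {t = t} p q) =
  let s′ , p′ , s′≤ = focusᶜ-run r p
      t′ , q′ , t′≤ = focusᶜ-run r q
  in  s′ + t′ , seq p′ q′ ,
      ≤-trans (+-mono-≤ s′≤ t′≤) (≤-reflexive (sym (*-distribˡ-+ 4 s t)))
focusᶜ-run r (if-true {e = e} {σ = σ} eq p) =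
  let t′ , p′ , t′≤ = focusᶜ-run r p
  in  _ , if-true (trans (focusᵉ-sound e r σ) eq) p′ , test-bound e t′≤
focusᶜ-run r (if-false {e = e} {σ = σ} eq p) =
  let t′ , p′ , t′≤ = focusᶜ-run r p
  in  _ , if-false (trans (focusᵉ-sound e r σ) eq) p′ , test-bound e t′≤
focusᶜ-run r (while-true {e = e} {σ = σ} {s = s} {t = t} eq p q) =
  let s′ , p′ , s′≤ = focusᶜ-run r p
      t′ , q′ , t′≤ = focusᶜ-run r q
  in  _ , while-true (trans (focusᵉ-sound e r σ) eq) p′ q′ ,
      test-bound e (≤-trans (+-mono-≤ s′≤ t′≤) (≤-reflexive (sym (*-distribˡ-+ 4 s t))))
focusᶜ-run r (while-false {e = e} {σ = σ} eq) =
  _ , while-false (trans (focusᵉ-sound e r σ) eq) ,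
  subst₂ _≤_ (+-identityʳ _) (cong (4 *_) (+-identityʳ (suc (cost e)))) (test-bound e {0} z≤n)

focus : (r : A → Tree) → Realizes inp out T →
        Realizes (λ a → cons (inp a) (r a)) (λ a → cons (out a) (r a)) T
focus r R .cmd    = focusᶜ (R .cmd)
focus r R .factor = 4 * R .factor
focus r R .run a  =
  let t , p , t≤ = R .run a
      t′ , p′ , t′≤ = focusᶜ-run (r a) p
  in  t′ , p′ , ≤-trans t′≤ (≤-trans (*-monoʳ-≤ 4 t≤) (≤-reflexive (sym (*-assoc 4 (R .factor) _))))

-- The state serves as a stack: the result is pushed on top and everything below stays available, so
-- later expressions reach an item by counting tails.
call : ∀ {st : A → Tree} (e : Expr 1) → (∀ a → ⟦ e ⟧ (st a ∷ []) ≡ inp a) →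
       Realizes inp out T → Realizes st (λ a → cons (out a) (st a)) T
call {st = st} e eq R =
  set (`cons e x₀) (λ a → cong (λ v → cons v (st a)) (eq a)) ▸ focus st R

-- The processed elements are kept in reverse order, so that processing one
-- more is a cons and the equation in `LoopStep` is preserved definitionally.

module _ {A : Set} (X : A → Set) (enc : ∀ a → X a → Tree) (l : ∀ a → List (X a))
         (R : ∀ a → List (X a) → List (X a) → Tree) where

  LoopStep : Set
  LoopStep = Σ[ a ∈ A ] Σ[ zs ∈ List (X a) ] Σ[ x ∈ X a ] Σ[ xs ∈ List (X a) ]
             xs ʳ++ (x ∷ zs) ≡ reverse (l a)

  loop-state : ∀ a → List (X a) → List (X a) → Tree
  loop-state a zs xs = cons (encodeList (enc a) xs) (R a zs xs)

  iterate : {T : A → ℕ} →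
         Realizes {LoopStep} (λ (a , zs , x , xs , _) → loop-state a zs (x ∷ xs))
                             (λ (a , zs , x , xs , _) → loop-state a (x ∷ zs) xs)
                             (λ (a , _) → T a) →
         Realizes (λ a → loop-state a [] (l a)) (λ a → loop-state a (reverse (l a)) [])
                  (λ a → length (l a) * suc (T a))
  iterate body .cmd    = while `head x₀ loop body .cmd
  -- 3 is the cost of one evaluation of the loop test.
  iterate body .factor = 3 + body .factor
  iterate {T} body .run a = go [] (l a) refl
    where
    open ≤-Reasoning
    F = body .factor
    U = suc (T a)

    shape : ∀ F U m → 3 * U + (F * U + (3 + F) * suc (m * U)) ≡ (3 + F) * suc (U + m * U)
    shape = solve-∀

    go : ∀ zs xs → xs ʳ++ zs ≡ reverse (l a) →
         while `head x₀ loop body .cmd , loop-state a zs xs ⇓ loop-state a (reverse (l a)) []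
           within (3 + F) * suc (length xs * U)
    go zs [] refl = 3 , while-false refl , m≤n⇒m≤n*o 1 (m≤m+n 3 F)
    go zs (x ∷ xs) eq =
      let s , p , s≤ = body .run (a , zs , x , xs , eq)
          t , q , t≤ = go (x ∷ zs) xs eq
      in  3 + (s + t) , while-true refl p q , (begin
            3 + (s + t)                                         ≤⟨ +-monoʳ-≤ 3 (+-mono-≤ s≤ t≤) ⟩
            3 + (F * U + (3 + F) * suc (length xs * U))         ≤⟨ +-monoˡ-≤ _ (m≤m*n 3 U) ⟩
            3 * U + (F * U + (3 + F) * suc (length xs * U))     ≡⟨ shape F U (length xs) ⟩
            (3 + F) * suc (U + length xs * U)                   ∎)

reversal : ∀ {A : Set} (X : A → Set) (enc : ∀ a → X a → Tree) (l : ∀ a → List (X a)) →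
           Realizes (λ a → encodeList (enc a) (l a)) (λ a → encodeList (enc a) (reverse (l a)))
                    (λ a → length (l a))
reversal X enc l = weaken (λ a → ≤-reflexive (*-identityʳ (length (l a))))
  (  set (`cons x₀ `nil) (λ _ → refl)
   ▸ iterate X enc l (λ a zs _ → encodeList (enc a) zs) {T = λ _ → 0}
       (set (`cons (`tail (`head x₀)) (`cons (`head (`head x₀)) (`tail x₀))) (λ _ → refl))
   ▸ set (`tail x₀) (λ _ → refl))

module _ {A : Set} (X : A → Set) (enc : ∀ a → X a → Tree) (l : ∀ a → List (X a))
         (F : ∀ a → List (X a) → Tree) where

  -- The equation says that `x ∷ zs` is a suffix of `l a`; from it a body can bound its own running
  -- time in terms of `a`.
  FoldStep : Set
  FoldStep = Σ[ a ∈ A ] Σ[ x ∈ X a ] Σ[ zs ∈ List (X a) ] Σ[ ys ∈ List (X a) ]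
             ys ʳ++ (x ∷ zs) ≡ l a

  FoldBody : (A → ℕ) → Set
  FoldBody T = Realizes {FoldStep} (λ (a , x , zs , _) → cons (enc a x) (F a zs))
                                   (λ (a , x , zs , _) → F a (x ∷ zs))
                                   (λ (a , _) → T a)

  -- `iterate` consumes a list from the front, whereas `F` grows from the back as `foldr` does;
  -- hence the list must arrive reversed.
  fold-reversed : {T : A → ℕ} → FoldBody T →
                  Realizes (λ a → cons (encodeList (enc a) (reverse (l a))) (F a [])) (λ a → F a (l a))
                           (λ a → length (l a) * suc (T a))
  fold-reversed {T} body = respect (λ _ → refl) (λ a → cong (F a) (reverse-involutive (l a)))
    (weaken (λ a → ≤-reflexive (cong (_* suc (T a)) (length-reverse (l a))))
    (  iterate X enc (reverse ∘ l) (λ a zs _ → F a zs) {T}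
         (  set (`cons (`cons (`head (`head x₀)) (`tail x₀)) (`tail (`head x₀))) (λ _ → refl)
          ▸ focus (λ (a , _ , _ , xs , _) → encodeList (enc a) xs)
              (reindex (λ (a , zs , x , xs , eq) → a , x , zs , xs , trans eq (reverse-involutive (l a))) body)
          ▸ set (`cons (`tail x₀) (`head x₀)) (λ _ → refl))
     ▸ set (`tail x₀) (λ _ → refl)))

  fold : {T : A → ℕ} → FoldBody T →
         Realizes (λ a → cons (encodeList (enc a) (l a)) (F a [])) (λ a → F a (l a))
                  (λ a → length (l a) * suc (T a))
  fold {T} body =
      focus (λ a → F a []) (weaken (λ a → m≤m*n (length (l a)) (suc (T a))) (reversal X enc l))
    ▸ fold-reversed body

-- Unary numbers and bounded unions

unary : ℕ → Tree
unary zero    = nil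
unary (suc n) = cons nil (unary n)

unary-list : ∀ n → encodeList (λ _ → nil) (replicate n tt) ≡ unary n
unary-list zero    = refl
unary-list (suc n) = cong (cons nil) (unary-list n)

-- Exposes two constructors per step, so that a loop round which conses twice is correct by `refl`.
double : ℕ → ℕ
double zero    = 0
double (suc n) = suc (suc (double n))

double≡2* : ∀ n → double n ≡ 2 * n
double≡2* zero    = refl
double≡2* (suc n) = cong suc (trans (cong suc (double≡2* n)) (sym (+-suc n (n + 0))))

doubling : Realizes unary (unary ∘ double) id
doubling = weaken (λ n → ≤-reflexive (trans (*-identityʳ _) (length-replicate n)))
  (  set (`cons x₀ `nil) (λ n → cong (λ t → cons t nil) (sym (unary-list n)))
   ▸ respect (λ _ → refl) (λ n → cong (unary ∘ double) (length-replicate n))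
       (fold (λ _ → ⊤) (λ _ _ → nil) (λ n → replicate n tt) (λ _ zs → unary (double (length zs))) {T = λ _ → 0}
         (set (`cons `nil (`cons `nil (`tail x₀))) (λ _ → refl))))

-- From binary to unary

bump : Bool → ℕ → ℕ
bump true  m = suc (suc m)
bump false m = suc m

value : List Bool → ℕ
value []       = 0
value (d ∷ ds) = bump d (double (value ds))

digits : ℕᵇ → List Bool
digits ℕᵇ.zero  = []
digits 2[1+ n ] = true ∷ digits n
digits 1+[2 n ] = false ∷ digits n

encode-digits : ∀ n → encodeList encodeBool (digits n) ≡ encodeℕᵇ n
encode-digits ℕᵇ.zero  = refl
encode-digits 2[1+ n ] = cong (cons _) (encode-digits n)
encode-digits 1+[2 n ] = cong (cons _) (encode-digits n)

value-digits : ∀ n → value (digits n) ≡ ℕᵇ.toℕ n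
value-digits ℕᵇ.zero  = refl
value-digits 2[1+ n ] = trans (cong (suc ∘ suc ∘ double) (value-digits n)) (double≡2* (suc (ℕᵇ.toℕ n)))
value-digits 1+[2 n ] = trans (cong (suc ∘ double) (value-digits n)) (cong suc (double≡2* (ℕᵇ.toℕ n)))

value-∷ : ∀ d ds → value ds < value (d ∷ ds)
value-∷ d ds = ≤-trans (s≤s (≤-trans (m≤m+n (value ds) _) (≤-reflexive (sym (double≡2* (value ds))))))
                       (bump-> d)
  where
  bump-> : ∀ d {m} → m < bump d m
  bump-> true  = m<n⇒m<1+n ≤-refl
  bump-> false = ≤-refl

-- Bijective binary has no digit zero, so every digit increases the value.
length≤value : ∀ ds → length ds ≤ value ds
length≤value []       = z≤n
length≤value (d ∷ ds) = ≤-trans (s≤s (length≤value ds)) (value-∷ d ds)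

value-ʳ++ : ∀ ys zs → value zs ≤ value (ys ʳ++ zs)
value-ʳ++ []       zs = ≤-refl
value-ʳ++ (y ∷ ys) zs = ≤-trans (<⇒≤ (value-∷ y zs)) (value-ʳ++ ys (y ∷ zs))

-- Horner's scheme: the least significant digit comes first, so a right fold meets the digits in the
-- right order. Values of suffixes stay below the final value, which also bounds the number of
-- digits; hence the quadratic time.
evaluation : Realizes (encodeList encodeBool) (unary ∘ value) (λ ds → value ds * suc (value ds))
evaluation = weaken (λ ds → *-monoˡ-≤ (suc (value ds)) (length≤value ds))
  (  set (`cons x₀ `nil) (λ _ → refl)
   ▸ fold (λ _ → Bool) (λ _ → encodeBool) id (λ _ → unary ∘ value)
       (  call (`tail x₀) (λ _ → refl)
            (weaken (λ { (_ , d , zs , ys , refl) → ≤-trans (<⇒≤ (value-∷ d zs)) (value-ʳ++ ys (d ∷ zs)) })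
            (reindex (λ (_ , _ , zs , _) → value zs) doubling))
        ▸ by-decision (test `head (`tail x₀)
                         yes return (`cons `nil (`cons `nil (`head x₀)))
                         no  return (`cons `nil (`head x₀)))
            λ { (_ , true , _) → refl ; (_ , false , _) → refl }))

toUnary : Realizes encodeℕ unary (λ k → k * suc k)
toUnary = respect (encode-digits ∘ ℕᵇ.fromℕ) (cong unary ∘ value-fromℕ)
  (weaken (λ k → ≤-reflexive (cong (λ m → m * suc m) (value-fromℕ k)))
  (reindex (digits ∘ ℕᵇ.fromℕ) evaluation))
  where
  value-fromℕ : ∀ k → value (digits (ℕᵇ.fromℕ k)) ≡ k
  value-fromℕ k = trans (value-digits (ℕᵇ.fromℕ k)) (toℕ-fromℕ k)

-- Adding a set on a budget

Candidate : ℕ → Set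
Candidate n = Subset n × ℕ

-- `add p q b` is p ∪ q with what is left of the budget b after paying one unit
-- for each element of p outside q; `extend` treats a single position.

extend : ∀ {n} → Bool → Bool → Maybe (Candidate n) → Maybe (Candidate (suc n))
extend t     s     nothing            = nothing
extend false s     (just (u , b))     = just (s ∷ u , b)
extend true  true  (just (u , b))     = just (true ∷ u , b)
extend true  false (just (u , zero))  = nothing
extend true  false (just (u , suc b)) = just (true ∷ u , b)

add : ∀ {n} → Subset n → Subset n → ℕ → Maybe (Candidate n)
add []      []      b = just ([] , b)
add (t ∷ p) (s ∷ q) b = extend t s (add p q b)

encodeSet : ∀ {n} → Subset n → Tree
encodeSet p = encodeList encodeBool (toList p)

encodeCandidate : ∀ {n} → Candidate n → Tree
encodeCandidate (s , b) = cons (encodeSet s) (unary b)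

encodeResult : ∀ {n} → Maybe (Candidate n) → Tree
encodeResult = maybe encodeCandidate nil

encodePair : Bool × Bool → Tree
encodePair (t , s) = cons (encodeBool t) (encodeBool s)

-- A fold traverses one list, so the two bit vectors are merged beforehand; the pairs come out
-- reversed, just as `fold-reversed` wants them.
zipping : Realizes (λ ps → cons (encodeList (encodeBool ∘ proj₁) ps) (encodeList (encodeBool ∘ proj₂) ps))
                   (encodeList encodePair ∘ reverse) length
zipping = weaken (λ ps → ≤-reflexive (*-identityʳ (length ps)))
  (  set (`cons (`head x₀) (`cons (`tail x₀) `nil)) (λ _ → refl)
   ▸ iterate (λ _ → Bool × Bool) (λ _ → encodeBool ∘ proj₁) id
       (λ _ zs ps → cons (encodeList (encodeBool ∘ proj₂) ps) (encodeList encodePair zs)) {T = λ _ → 0}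
       (set (`cons (`tail (`head x₀))
                   (`cons (`tail (`head (`tail x₀)))
                          (`cons (`cons (`head (`head x₀)) (`head (`head (`tail x₀)))) (`tail (`tail x₀)))))
            (λ _ → refl))
   ▸ set (`tail (`tail x₀)) (λ _ → refl))

`true : Expr 1
`true = `cons `nil `nil

extend-decision : Decision
extend-decision =
  let t = `head (`head x₀) ; s = `tail (`head x₀) ; u = `head (`tail x₀) ; b = `tail (`tail x₀)
  in  test `tail x₀
        yes (test t
               yes (test s
                      yes return (`cons (`cons `true u) b)
                      no  (test b
                             yes return (`cons (`cons `true u) (`tail b))
                             no  return `nil))
               no  return (`cons (`cons s u) b))
        no  return `nil

add-tree : ℕ → List (Bool × Bool) → Tree
add-tree b = foldr (λ p r → decide extend-decision (cons (encodePair p) r)) (cons nil (unary b))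

extend-tree : ∀ {n} t s (r : Maybe (Candidate n)) →
              decide extend-decision (cons (encodePair (t , s)) (encodeResult r)) ≡ encodeResult (extend t s r)
extend-tree t     s     nothing            = refl
extend-tree false s     (just (u , b))     = refl
extend-tree true  true  (just (u , b))     = refl
extend-tree true  false (just (u , zero))  = refl
extend-tree true  false (just (u , suc b)) = refl

add-tree-zip : ∀ {n} (p q : Subset n) b → add-tree b (toList (Vec.zip p q)) ≡ encodeResult (add p q b)
add-tree-zip []      []      b = refl
add-tree-zip (t ∷ p) (s ∷ q) b =
  trans (cong (decide extend-decision ∘ cons (encodePair (t , s))) (add-tree-zip p q b))
        (extend-tree t s (add p q b))

encode-zip₁ : ∀ {n} (p q : Subset n) → encodeList (encodeBool ∘ proj₁) (toList (Vec.zip p q)) ≡ encodeSet p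
encode-zip₁ []      []      = refl
encode-zip₁ (t ∷ p) (s ∷ q) = cong (cons _) (encode-zip₁ p q)

encode-zip₂ : ∀ {n} (p q : Subset n) → encodeList (encodeBool ∘ proj₂) (toList (Vec.zip p q)) ≡ encodeSet q
encode-zip₂ []      []      = refl
encode-zip₂ (t ∷ p) (s ∷ q) = cong (cons _) (encode-zip₂ p q)

module _ {A : Set} (n : A → ℕ) (p q : ∀ a → Subset (n a)) (b : A → ℕ) where
  private
    pairs : A → List (Bool × Bool)
    pairs a = toList (Vec.zip (p a) (q a))

    length-pairs : ∀ a → length (pairs a) ≡ n a
    length-pairs a = length-toList (Vec.zip (p a) (q a))

  -- The time is independent of `b`: the unary budget is never traversed, and each position removes
  -- at most one cell from it.
  adding : Realizes (λ a → cons (encodeSet (p a)) (encodeCandidate (q a , b a)))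
                    (λ a → encodeResult (add (p a) (q a) (b a))) n
  adding = respect
    (λ a → cong₂ (λ s t → cons s (cons t (unary (b a)))) (encode-zip₁ (p a) (q a)) (encode-zip₂ (p a) (q a)))
    (λ a → add-tree-zip (p a) (q a) (b a))
    (  call (`cons (`head x₀) (`head (`tail x₀))) (λ _ → refl)
         (weaken (λ a → ≤-reflexive (length-pairs a)) (reindex pairs zipping))
     ▸ set (`cons (`head x₀) (`cons `nil (`tail (`tail (`tail x₀))))) (λ _ → refl)
     ▸ weaken (λ a → ≤-reflexive (trans (*-identityʳ _) (length-pairs a)))
         (fold-reversed (λ _ → Bool × Bool) (λ _ → encodePair) pairs (λ a → add-tree (b a)) {T = λ _ → 0}
           (by-decision extend-decision (λ _ → refl))))

-- The algorithm

prepend : ∀ {n} → Subset n → Candidate n → List (Candidate n) → List (Candidate n)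
prepend t (s , b) L = maybe (_∷ L) L (add t s b)

-- Paying for all of `p` out of a budget of `i` fails exactly when `p` has more than `i` elements.
exceeds : ∀ {n} → ℕ → Subset n → Bool
exceeds i p = is-nothing (add p ⊥ i)

-- The two additions with budget 0 are inclusion tests: they succeed exactly when nothing has to be
-- paid.
refine : ∀ {n} → Subset n → Subset n → Candidate n → List (Candidate n) → List (Candidate n)
refine p q c L with add p (proj₁ c) 0 | add q (proj₁ c) 0
... | just _  | _       = c ∷ L
... | nothing | just _  = c ∷ L
... | nothing | nothing = prepend p c (prepend q c L)

process : ∀ {n} → Subset n → Subset n → List (Candidate n) → List (Candidate n)
process p q = foldr (refine p q) []

starts : ∀ {n} → ℕ → List (Subset n) → List (Candidate n)
starts k = foldr (λ t → prepend t (⊥ , k)) []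

module _ (G : Graph) where

  -- Off by one: the threshold i selects the vertices of degree at least i + 1.

  highVertices : ℕ → Subset (order G)
  highVertices i = Vec.tabulate (exceeds i ∘ neighbours G)

  highSets : ℕ → List (Subset (order G))
  highSets i = highVertices i
             ∷ map (neighbours G) (filterᵇ (exceeds i ∘ neighbours G) (allFin (order G)))

  -- Descends to the first threshold `suc i` attained by more than `i` vertices; from the order of
  -- the graph downwards, this is the h-index. The program counts upwards instead and overwrites its
  -- list at each success.
  startSets : ℕ → List (Subset (order G))
  startSets zero    = ⊥ ∷ []
  startSets (suc i) = maybe (λ _ → startSets i) (highSets i) (add (highVertices i) ⊥ i)

  search : List (Candidate (order G)) → List (Vertex G) → List (Candidate (order G))
  search = foldr (λ v → process ⁅ v ⁆ (neighbours G v))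

  encodeVertex : Vertex G → Tree
  encodeVertex v = cons (encodeSet ⁅ v ⁆) (encodeSet (neighbours G v))

  -- Sets are bit vectors of length n, so the empty set has to be kept at hand for size tests and
  -- initial candidates.
  encodeVertices : Tree
  encodeVertices = cons (encodeSet (⊥ {order G})) (encodeList encodeVertex (allFin (order G)))

-- Programs preparing the vertex data

encodeList-map : ∀ {A B : Set} (enc : B → Tree) (f : A → B) xs →
                 encodeList enc (map f xs) ≡ encodeList (enc ∘ f) xs
encodeList-map enc f []       = refl
encodeList-map enc f (x ∷ xs) = cong (cons (enc (f x))) (encodeList-map enc f xs)

encodeList-tabulate : ∀ {A : Set} (enc : A → Tree) {n} (f : Fin n → A) →
                      encodeList enc (tabulate f) ≡ encodeList (enc ∘ f) (allFin n)
encodeList-tabulate enc f =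
  trans (cong (encodeList enc) (sym (map-tabulate id f))) (encodeList-map enc f (allFin _))

toList-tabulate : ∀ {A : Set} {n} (f : Fin n → A) → toList (Vec.tabulate f) ≡ tabulate f
toList-tabulate {n = zero}  f = refl
toList-tabulate {n = suc n} f = cong (f zero ∷_) (toList-tabulate (f ∘ Fin.suc))

encodeList-cong : ∀ {A : Set} {e e′ : A → Tree} → (∀ x → e x ≡ e′ x) → ∀ xs → encodeList e xs ≡ encodeList e′ xs
encodeList-cong eq []       = refl
encodeList-cong eq (x ∷ xs) = cong₂ cons (eq x) (encodeList-cong eq xs)

encodeGraph-rows : ∀ G → encodeList (encodeSet ∘ neighbours G) (allFin (order G)) ≡ encodeGraph G
encodeGraph-rows G = trans
  (encodeList-cong (cong (encodeList encodeBool) ∘ toList-tabulate ∘ adjacent G) (allFin (order G)))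
  (sym (encodeList-tabulate (encodeList encodeBool) (λ u → tabulate (adjacent G u))))

-- An identity matrix grown from the last row: a new front element shifts every earlier unit vector
-- by one position. This builds the singletons without any index arithmetic.
withUnits : {R : Set} → List R → List (List Bool × R)
withUnits []       = []
withUnits (r ∷ rs) = (true ∷ replicate (length rs) false , r) ∷ map (map₁ (false ∷_)) (withUnits rs)

length-withUnits : ∀ {R : Set} (rs : List R) → length (withUnits rs) ≡ length rs
length-withUnits []       = refl
length-withUnits (r ∷ rs) = cong suc (trans (length-map _ (withUnits rs)) (length-withUnits rs))

withUnits-tabulate : ∀ {R : Set} {n} (f : Fin n → R) →
                     withUnits (tabulate f) ≡ tabulate (λ v → toList ⁅ v ⁆ , f v)
withUnits-tabulate {n = zero}  f = refl
withUnits-tabulate {n = suc n} f = cong₂ (λ z us → (true ∷ z , f zero) ∷ us)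
  (trans (cong (λ m → replicate m false) (length-tabulate (f ∘ Fin.suc))) (sym (toList-replicate n false)))
  (trans (cong (map _) (withUnits-tabulate (f ∘ Fin.suc))) (map-tabulate _ _))

length-suffix : ∀ {X : Set} ys {zs xs : List X} → ys ʳ++ zs ≡ xs → length zs ≤ length xs
length-suffix ys {zs} refl = subst (length zs ≤_) (sym (length-ʳ++ ys)) (m≤n+m _ _)

length-allFin : ∀ n → length (allFin n) ≡ n
length-allFin n = length-tabulate id

encodeUnitRow : ∀ G → List Bool × Vertex G → Tree
encodeUnitRow G (e , v) = cons (encodeList encodeBool e) (encodeSet (neighbours G v))

shifting : Realizes {Σ[ G ∈ Graph ] List (List Bool × Vertex G)}
             (λ (G , us) → encodeList (encodeUnitRow G) us)
             (λ (G , us) → encodeList (encodeUnitRow G) (map (map₁ (false ∷_)) us))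
             (λ (G , us) → length us)
shifting = weaken (λ (_ , us) → ≤-reflexive (*-identityʳ (length us)))
  (  set (`cons x₀ `nil) (λ _ → refl)
   ▸ fold (λ (G , _) → List Bool × Vertex G) (λ (G , _) → encodeUnitRow G) proj₂
       (λ (G , _) us → encodeList (encodeUnitRow G) (map (map₁ (false ∷_)) us)) {T = λ _ → 0}
       (set (`cons (`cons (`cons `nil (`head (`head x₀))) (`tail (`head x₀))) (`tail x₀)) (λ _ → refl)))

preparation : Realizes encodeGraph encodeVertices (λ G → order G * suc (order G))
preparation = respect encodeGraph-rows
  (λ G → cong₂ cons
    (cong (encodeList encodeBool)
      (trans (cong (λ m → replicate m false) (length-allFin (order G))) (sym (toList-replicate (order G) false))))
    (trans (cong (encodeList (encodeUnitRow G)) (withUnits-tabulate {n = order G} id))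
           (encodeList-tabulate (encodeUnitRow G) _)))
  (weaken (λ G → ≤-reflexive (cong (_* suc (order G)) (length-allFin (order G))))
  (  set (`cons x₀ (`cons `nil `nil)) (λ _ → refl)
   ▸ fold Vertex (λ G → encodeSet ∘ neighbours G) (allFin ∘ order)
       (λ G zs → cons (encodeList encodeBool (replicate (length zs) false))
                      (encodeList (encodeUnitRow G) (withUnits zs)))
       (  call (`tail (`tail x₀)) (λ _ → refl)
            (weaken (λ (G , v , zs , ys , eq) → subst₂ _≤_ (sym (length-withUnits zs)) (length-allFin (order G))
                                                    (≤-trans (n≤1+n _) (length-suffix ys eq)))
            (reindex (λ (G , _ , zs , _) → G , withUnits zs) shifting))
        ▸ set (let z = `head (`tail (`tail x₀))
               in `cons (`cons `nil z) (`cons (`cons (`cons `true z) (`head (`tail x₀))) (`head x₀)))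
              (λ _ → refl))))

-- Programs for the start sets

highState : ∀ G → ℕ → List (Vertex G) → Tree
highState G i zs =
  cons (encodeCandidate (⊥ {order G} , i))
       (cons (encodeList encodeBool (map (exceeds i ∘ neighbours G) zs))
             (encodeList encodeSet (map (neighbours G) (filterᵇ (exceeds i ∘ neighbours G) zs))))

highDecision : Decision
highDecision =
  let r = `tail (`head (`tail x₀)) ; budget = `head (`tail (`tail x₀))
      H = `head (`tail (`tail (`tail x₀))) ; rows = `tail (`tail (`tail (`tail x₀)))
  in  test `head x₀
        yes return (`cons budget (`cons (`cons `nil H) rows))
        no  return (`cons budget (`cons (`cons `true H) (`cons r rows)))

highDecision-sound : ∀ G i v zs →
  decide highDecision (cons (encodeResult (add (neighbours G v) ⊥ i)) (cons (encodeVertex G v) (highState G i zs)))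
  ≡ highState G i (v ∷ zs)
highDecision-sound G i v zs with add (neighbours G v) ⊥ i
... | just _  = refl
... | nothing = refl

findHighSets : Realizes {Graph × ℕ}
                 (λ (G , i) → cons (unary i) (encodeVertices G))
                 (λ (G , i) → encodeList encodeSet (highSets G i))
                 (λ (G , i) → order G * suc (order G))
findHighSets = respect (λ _ → refl)
  (λ (G , i) → cong (λ h → cons (encodeList encodeBool h) (encodeList encodeSet (List.drop 1 (highSets G i))))
    (trans (map-tabulate id (exceeds i ∘ neighbours G)) (sym (toList-tabulate (exceeds i ∘ neighbours G)))))
  (weaken (λ (G , _) → ≤-reflexive (cong (_* suc (order G)) (length-allFin (order G))))
  (  set (`cons (`tail (`tail x₀)) (`cons (`cons (`head (`tail x₀)) (`head x₀)) (`cons `nil `nil))) (λ _ → refl)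
   ▸ fold (λ (G , _) → Vertex G) (λ (G , _) → encodeVertex G) (λ (G , _) → allFin (order G))
       (λ (G , i) → highState G i)
       (  call (`cons (`tail (`head x₀)) (`head (`tail x₀))) (λ _ → refl)
            (adding (λ ((G , _) , _) → order G) (λ ((G , _) , v , _) → neighbours G v) (λ _ → ⊥)
                    (λ ((_ , i) , _) → i))
        ▸ by-decision highDecision (λ ((G , i) , v , zs , _) → highDecision-sound G i v zs))
   ▸ set (`tail x₀) (λ _ → refl)))

startDecision : Decision
startDecision =
  let Hs = `head (`tail x₀) ; V = `head (`tail (`tail (`tail x₀)))
      i = `head (`tail (`tail (`tail (`tail x₀)))) ; C = `tail (`tail (`tail (`tail (`tail x₀))))
  in  test `head x₀
        yes return (`cons V (`cons (`cons `nil i) C))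
        no  return (`cons V (`cons (`cons `nil i) Hs))

startState : Graph → ℕ → Tree
startState G i = cons (encodeVertices G) (cons (unary i) (encodeList encodeSet (startSets G i)))

startDecision-sound : ∀ G i t →
  decide startDecision (cons (encodeResult (add (highVertices G i) ⊥ i))
                       (cons (encodeList encodeSet (highSets G i)) (cons t (startState G i))))
  ≡ startState G (suc i)
startDecision-sound G i t with add (highVertices G i) ⊥ i
... | just _  = refl
... | nothing = refl

findStartSets : Realizes encodeVertices (λ G → encodeList encodeSet (startSets G (order G)))
                         (λ G → order G * suc (order G * suc (order G)))
findStartSets = respect (λ _ → refl) (λ G → cong (encodeList encodeSet ∘ startSets G) (length-allFin (order G)))
  (weaken (λ G → ≤-reflexive (cong (_* suc (order G * suc (order G))) (length-allFin (order G))))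
  (  set (`cons (`tail x₀) (`cons x₀ (`cons `nil (`cons (`head x₀) `nil)))) (λ _ → refl)
   -- The vertex list acts only as a counter: the number of vertices already processed is the
   -- current threshold.
   ▸ fold Vertex encodeVertex (allFin ∘ order) (λ G zs → startState G (length zs))
       (  call (`cons (`head (`tail (`tail x₀))) (`head (`tail x₀))) (λ _ → refl)
            (reindex (λ (G , _ , zs , _) → G , length zs) findHighSets)
        ▸ call (`cons (`head (`head x₀))
                      (`cons (`head (`head (`tail (`tail x₀)))) (`head (`tail (`tail (`tail x₀)))))) (λ _ → refl)
            (weaken (λ (G , _) → m≤m*n (order G) (suc (order G)))
            (adding (λ (G , _) → order G) (λ (G , _ , zs , _) → highVertices G (length zs)) (λ _ → ⊥)
                    (λ (_ , _ , zs , _) → length zs)))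
        ▸ by-decision startDecision (λ (G , v , zs , _) → startDecision-sound G (length zs) (encodeVertex G v)))
   ▸ set (`tail (`tail x₀)) (λ _ → refl)))

prependDecision : Decision
prependDecision =
  let c = `head (`tail (`tail x₀)) ; L = `tail (`tail (`tail x₀))
  in  test `head x₀ yes return (`cons c (`cons (`head x₀) L)) no return (`cons c L)

prependDecision-sound : ∀ {n} (t s : Subset n) b L r →
  decide prependDecision (cons (encodeResult (add t s b)) (cons r (cons (encodeCandidate (s , b)) (encodeList encodeCandidate L))))
  ≡ cons (encodeCandidate (s , b)) (encodeList encodeCandidate (prepend t (s , b) L))
prependDecision-sound t s b L r with add t s b
... | just _  = refl
... | nothing = refl

findStarts : Realizes {Σ[ n ∈ ℕ ] List (Subset n) × ℕ}
               (λ (n , C , k) → cons (encodeList encodeSet C) (encodeCandidate (⊥ {n} , k)))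
               (λ (n , C , k) → encodeList encodeCandidate (starts k C))
               (λ (n , C , _) → length C * suc n)
findStarts =
    set (`cons (`head x₀) (`cons (`tail x₀) `nil)) (λ _ → refl)
  ▸ fold (λ (n , _) → Subset n) (λ _ → encodeSet) (λ (_ , C , _) → C)
       (λ (n , _ , k) C → cons (encodeCandidate (⊥ {n} , k)) (encodeList encodeCandidate (starts k C)))
       (  call (`cons (`head x₀) (`head (`tail x₀))) (λ _ → refl)
            (adding (λ ((n , _) , _) → n) (λ (_ , t , _) → t) (λ _ → ⊥) (λ ((_ , _ , k) , _) → k))
       ▸ by-decision prependDecision
            (λ ((n , _ , k) , t , zs , _) → prependDecision-sound t ⊥ k (starts k zs) (encodeSet t)))
  ▸ set (`tail x₀) (λ _ → refl)

-- Programs for the sweep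

refineDecision : Decision
refineDecision =
  let r₄ = `head x₀ ; r₃ = `head (`tail x₀) ; r₂ = `head (`tail (`tail x₀))
      r₁ = `head (`tail (`tail (`tail x₀)))
      s  = `tail (`tail (`tail (`tail x₀)))
      c = `head s ; pq = `head (`tail s) ; L = `tail (`tail s)
      keep = return (`cons pq (`cons c L))
  in  test r₁ yes keep no
      (test r₂ yes keep no
      (test r₃
         yes (test r₄
                yes return (`cons pq (`cons r₃ (`cons r₄ L)))
                no  return (`cons pq (`cons r₃ L)))
         no  (test r₄
                yes return (`cons pq (`cons r₄ L))
                no  return (`cons pq L))))

refineDecision-sound : ∀ {n} (p q s : Subset n) b L →
  let pq = cons (encodeSet p) (encodeSet q) in
  decide refineDecision
    (cons (encodeResult (add q s b)) (cons (encodeResult (add p s b))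
    (cons (encodeResult (add q s 0)) (cons (encodeResult (add p s 0))
    (cons (encodeCandidate (s , b)) (cons pq (encodeList encodeCandidate L)))))))
  ≡ cons pq (encodeList encodeCandidate (refine p q (s , b) L))
refineDecision-sound p q s b L with add p s 0 | add q s 0
... | just _  | _       = refl
... | nothing | just _  = refl
... | nothing | nothing with add p s b | add q s b
...   | just _  | just _  = refl
...   | just _  | nothing = refl
...   | nothing | just _  = refl
...   | nothing | nothing = refl

processing : Realizes {Σ[ n ∈ ℕ ] Subset n × Subset n × List (Candidate n)}
               (λ (n , p , q , L) → cons (cons (encodeSet p) (encodeSet q)) (encodeList encodeCandidate L))
               (λ (n , p , q , L) → encodeList encodeCandidate (process p q L))
               (λ (n , p , q , L) → length L * suc n)
processing =
    set (`cons (`tail x₀) (`cons (`head x₀) `nil)) (λ _ → refl)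
  ▸ fold (λ (n , _) → Candidate n) (λ _ → encodeCandidate) (λ (_ , _ , _ , L) → L)
      (λ (n , p , q , _) L → cons (cons (encodeSet p) (encodeSet q)) (encodeList encodeCandidate (process p q L)))
      -- All four additions are computed before any is tested, so that the choice among them is
      -- loop-free: two inclusion tests with budget 0, then the two extensions.
      (  call (`cons (`head (`head (`tail x₀))) (`cons (`head (`head x₀)) `nil)) (λ _ → refl)
           (adding N (λ ((_ , p , _) , _) → p) (λ (_ , c , _) → proj₁ c) (λ _ → 0))
       ▸ call (`cons (`tail (`head (`tail (`tail x₀)))) (`cons (`head (`head (`tail x₀))) `nil)) (λ _ → refl)
           (adding N (λ ((_ , _ , q , _) , _) → q) (λ (_ , c , _) → proj₁ c) (λ _ → 0))
       ▸ call (`cons (`head (`head (`tail (`tail (`tail x₀))))) (`head (`tail (`tail x₀)))) (λ _ → refl)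
           (adding N (λ ((_ , p , _) , _) → p) (λ (_ , c , _) → proj₁ c) (λ (_ , c , _) → proj₂ c))
       ▸ call (`cons (`tail (`head (`tail (`tail (`tail (`tail x₀)))))) (`head (`tail (`tail (`tail x₀))))) (λ _ → refl)
           (adding N (λ ((_ , _ , q , _) , _) → q) (λ (_ , c , _) → proj₁ c) (λ (_ , c , _) → proj₂ c))
       ▸ by-decision refineDecision
           (λ ((_ , p , q , _) , (s , b) , zs , _) → refineDecision-sound p q s b (process p q zs)))
  ▸ set (`tail x₀) (λ _ → refl)
  where
  N : ∀ {n : ℕ → Set} {Z : Σ ℕ n → Set} → Σ (Σ ℕ n) Z → ℕ
  N ((n , _) , _) = n

-- A fold needs one time bound valid in every round, so the input carries a bound on the candidate
-- list after any sequence of vertices.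
record SearchInput : Set where
  field
    graph      : Graph
    candidates : List (Candidate (order graph))
    width      : ℕ
    narrow     : ∀ vs → length (search graph candidates vs) ≤ width

open SearchInput

searching : Realizes {SearchInput}
              (λ I → cons (encodeList (encodeVertex (graph I)) (allFin (order (graph I))))
                          (encodeList encodeCandidate (candidates I)))
              (λ I → encodeList encodeCandidate (search (graph I) (candidates I) (allFin (order (graph I)))))
              (λ I → order (graph I) * suc (width I * suc (order (graph I))))
searching =
  weaken (λ I → ≤-reflexive (cong (_* suc (width I * suc (order (graph I)))) (length-allFin (order (graph I)))))
  (fold (Vertex ∘ graph) (encodeVertex ∘ graph) (allFin ∘ order ∘ graph)
     (λ I → encodeList encodeCandidate ∘ search (graph I) (candidates I))
     (weaken (λ (I , _ , zs , _) → *-monoˡ-≤ (suc (order (graph I))) (narrow I zs))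
     (reindex (λ (I , v , zs , _) →
                 order (graph I) , ⁅ v ⁆ , neighbours (graph I) v , search (graph I) (candidates I) zs)
              processing)))

-- Correctness and width of the search

-- The total `b + ∣ q ∣` is the invariant: success preserves it, failure means that the union
-- exceeds it.
AddSpec : ∀ {n} → Subset n → Subset n → ℕ → Maybe (Candidate n) → Set
AddSpec p q b (just (u , b′)) = u ≡ p ∪ q × b′ + ∣ u ∣ ≡ b + ∣ q ∣
AddSpec p q b nothing         = b + ∣ q ∣ < ∣ p ∪ q ∣

add-spec : ∀ {n} (p q : Subset n) b → AddSpec p q b (add p q b)
add-spec []          []          b = refl , refl
add-spec (t ∷ p)     (s ∷ q)     b with add p q b | add-spec p q b
add-spec (false ∷ p) (false ∷ q) b | just _           | refl , eq = refl , eq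
add-spec (false ∷ p) (true ∷ q)  b | just (u , b′)    | refl , eq =
  refl , trans (+-suc b′ _) (trans (cong suc eq) (sym (+-suc b _)))
add-spec (true ∷ p)  (true ∷ q)  b | just (u , b′)    | refl , eq =
  refl , trans (+-suc b′ _) (trans (cong suc eq) (sym (+-suc b _)))
add-spec (true ∷ p)  (false ∷ q) b | just (u , zero)  | refl , eq = s≤s (≤-reflexive (sym eq))
add-spec (true ∷ p)  (false ∷ q) b | just (u , suc c) | refl , eq = refl , trans (+-suc c _) eq
add-spec (false ∷ p) (false ∷ q) b | nothing          | lt        = lt
add-spec (false ∷ p) (true ∷ q)  b | nothing          | lt        = ≤-trans (s≤s (≤-reflexive (+-suc b _))) (s≤s lt)
add-spec (true ∷ p)  (true ∷ q)  b | nothing          | lt        = ≤-trans (s≤s (≤-reflexive (+-suc b _))) (s≤s lt)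
add-spec (true ∷ p)  (false ∷ q) b | nothing          | lt        = m<n⇒m<1+n lt

+∣⊥∣ : ∀ b n → b + ∣ ⊥ {n} ∣ ≡ b
+∣⊥∣ b n = trans (cong (b +_) (∣⊥∣≡0 n)) (+-identityʳ b)

exceeds-spec : ∀ {n} i (p : Subset n) → exceeds i p ≡ (i <ᵇ ∣ p ∣)
exceeds-spec {n} i p with add p ⊥ i | add-spec p ⊥ i
... | just (u , b) | refl , eq = det (ofⁿ (≤⇒≯ ∣p∣≤i)) (<ᵇ-reflects-< i ∣ p ∣)
  where
  ∣p∣≤i : ∣ p ∣ ≤ i
  ∣p∣≤i = subst₂ _≤_ (cong ∣_∣ (∪-identityʳ p)) (trans eq (+∣⊥∣ i n)) (m≤n+m ∣ p ∪ ⊥ ∣ b)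
... | nothing | lt =
  det (ofʸ (subst₂ _<_ (+∣⊥∣ i n) (cong ∣_∣ (∪-identityʳ p)) lt)) (<ᵇ-reflects-< i ∣ p ∣)

∪-⊆ : ∀ {n} {p q r : Subset n} → p ⊆ r → q ⊆ r → p ∪ q ⊆ r
∪-⊆ {p = p} {q} p⊆r q⊆r x∈ = [ p⊆r , q⊆r ]′ (x∈p∪q⁻ p q x∈)

∣p∪q∣≤∣q∣⇒p⊆q : ∀ {n} (p q : Subset n) → ∣ p ∪ q ∣ ≤ ∣ q ∣ → p ⊆ q
∣p∪q∣≤∣q∣⇒p⊆q p q le {x} x∈p with x ∈? q
... | yes x∈q = x∈q
... | no  x∉q = contradiction (p⊂q⇒∣p∣<∣q∣ (q⊆p∪q p q , x , p⊆p∪q q x∈p , x∉q)) (≤⇒≯ le)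

free-add : ∀ {n} (p q : Subset n) {c} → add p q 0 ≡ just c → p ⊆ q
free-add p q eq with add p q 0 | add-spec p q 0
free-add p q refl | just (u , b) | refl , e = ∣p∪q∣≤∣q∣⇒p⊆q p q (subst (∣ p ∪ q ∣ ≤_) e (m≤n+m _ b))

paid-add : ∀ {n} (p q : Subset n) → add p q 0 ≡ nothing → ∣ q ∣ < ∣ p ∪ q ∣
paid-add p q eq with add p q 0 | add-spec p q 0
paid-add p q refl | nothing | lt = lt

-- Given `s ⊆ X`, the inequality says that the elements of `X` missing from `s` fit into the budget.
Promising : ∀ {n} → Subset n → Candidate n → Set
Promising X (s , b) = s ⊆ X × ∣ X ∣ ≤ b + ∣ s ∣

prepend-keeps : ∀ {n} {P : Candidate n → Set} t c {L} → Any P L → Any P (prepend t c L)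
prepend-keeps t (s , b) any with add t s b
... | just _  = there any
... | nothing = any

refine-keeps : ∀ {n} {P : Candidate n → Set} p q c {L} → Any P L → Any P (refine p q c L)
refine-keeps p q c any with add p (proj₁ c) 0 | add q (proj₁ c) 0
... | just _  | _       = there any
... | nothing | just _  = there any
... | nothing | nothing = prepend-keeps p c (prepend-keeps q c any)

module _ {n} {X : Subset n} where

  -- The addition cannot fail: the union stays inside `X`, whose size is within the total
  -- `b + ∣ s ∣`.
  prepend-promising : ∀ t c {L} → Promising X c → t ⊆ X → Any (Promising X) (prepend t c L)
  prepend-promising t (s , b) (s⊆X , ∣X∣≤) t⊆X with add t s b | add-spec t s b
  ... | just _  | refl , eq = here (∪-⊆ t⊆X s⊆X , subst (∣ X ∣ ≤_) (sym eq) ∣X∣≤)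
  ... | nothing | lt        = contradiction (≤-trans (p⊆q⇒∣p∣≤∣q∣ (∪-⊆ t⊆X s⊆X)) ∣X∣≤) (<⇒≱ lt)

  refine-promising : ∀ p q c {L} → p ⊆ X ⊎ q ⊆ X → Promising X c → Any (Promising X) (refine p q c L)
  refine-promising p q c pq pr with add p (proj₁ c) 0 | add q (proj₁ c) 0
  ... | just _  | _       = here pr
  ... | nothing | just _  = here pr
  ... | nothing | nothing = [ prepend-promising p c pr , prepend-keeps p c ∘ prepend-promising q c pr ]′ pq

  process-promising : ∀ p q → p ⊆ X ⊎ q ⊆ X → ∀ {L} → Any (Promising X) L → Any (Promising X) (process p q L)
  process-promising p q pq {c ∷ L} (here pr)   = refine-promising p q c pq pr
  process-promising p q pq {c ∷ L} (there any) = refine-keeps p q c (process-promising p q pq any)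

  starts-promising : ∀ {k} → ∣ X ∣ ≤ k → ∀ {C} → Any (_⊆ X) C → Any (Promising X) (starts k C)
  starts-promising {k} le {t ∷ C} (here t⊆X)  =
    prepend-promising t (⊥ , k) (⊥⊆ , m≤n⇒m≤n+o _ le) t⊆X
  starts-promising {k} le {t ∷ C} (there any) = prepend-keeps t (⊥ , k) (starts-promising le any)

-- Width of the candidate list

potential : ∀ {n} → List (Candidate n) → ℕ
potential []            = 0
potential ((_ , b) ∷ L) = 2 ^ b + potential L

length≤potential : ∀ {n} (L : List (Candidate n)) → length L ≤ potential L
length≤potential []            = z≤n
length≤potential ((_ , b) ∷ L) = +-mono-≤ (m^n>0 2 b) (length≤potential L)

-- By conservation of the total, the hypothesis bounds the remaining budget by `d`. It is applied
-- with one unit less when branching, and with `k ∸ h` for the start sets.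
prepend-potential : ∀ {n} (t s : Subset n) b {d} L → b + ∣ s ∣ ≤ d + ∣ t ∪ s ∣ →
                    potential (prepend t (s , b) L) ≤ 2 ^ d + potential L
prepend-potential t s b {d} L le with add t s b | add-spec t s b
... | just (_ , b′) | refl , eq =
  +-monoˡ-≤ _ (^-monoʳ-≤ 2 (+-cancelʳ-≤ ∣ t ∪ s ∣ b′ d (≤-trans (≤-reflexive eq) le)))
... | nothing       | _         = m≤n+m _ (2 ^ d)

prepend-exhausted : ∀ {n} (t s : Subset n) L → ∣ s ∣ < ∣ t ∪ s ∣ → prepend t (s , 0) L ≡ L
prepend-exhausted t s L lt with add t s 0 | add-spec t s 0
... | just (_ , b′) | refl , eq = contradiction (subst (∣ t ∪ s ∣ ≤_) eq (m≤n+m _ b′)) (<⇒≱ lt)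
... | nothing       | _         = refl

-- Two children of weight at most 2 ^ (b - 1) replace a parent of weight 2 ^ b. Budget 0 is
-- separate: there both extensions fail, whereas a truncated b - 1 would admit two children of
-- weight 1.
branch-potential : ∀ {n} (p q s : Subset n) b L → ∣ s ∣ < ∣ p ∪ s ∣ → ∣ s ∣ < ∣ q ∪ s ∣ →
                   potential (prepend p (s , b) (prepend q (s , b) L)) ≤ 2 ^ b + potential L
branch-potential p q s zero L p> q>
  rewrite prepend-exhausted q s L q> | prepend-exhausted p s L p> = m≤n+m _ 1
branch-potential p q s (suc b) L p> q> = begin
  potential (prepend p (s , suc b) (prepend q (s , suc b) L)) ≤⟨ prepend-potential p s (suc b) {b} _ (one-less p>) ⟩
  2 ^ b + potential (prepend q (s , suc b) L)                 ≤⟨ +-monoʳ-≤ (2 ^ b) (prepend-potential q s (suc b) {b} _ (one-less q>)) ⟩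
  2 ^ b + (2 ^ b + potential L)                               ≡⟨ shape (2 ^ b) (potential L) ⟩
  2 * 2 ^ b + potential L                                     ∎
  where
  open ≤-Reasoning
  shape : ∀ a l → a + (a + l) ≡ 2 * a + l
  shape = solve-∀
  one-less : ∀ {x y} → x < y → suc b + x ≤ b + y
  one-less {x} lt = ≤-trans (≤-reflexive (sym (+-suc b x))) (+-monoʳ-≤ b lt)

refine-potential : ∀ {n} (p q : Subset n) c L → potential (refine p q c L) ≤ 2 ^ proj₂ c + potential L
refine-potential p q (s , b) L with add p s 0 in p-eq | add q s 0 in q-eq
... | just _  | _       = ≤-refl
... | nothing | just _  = ≤-refl
... | nothing | nothing = branch-potential p q s b L (paid-add p s p-eq) (paid-add q s q-eq)

process-potential : ∀ {n} (p q : Subset n) L → potential (process p q L) ≤ potential L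
process-potential p q []            = z≤n
process-potential p q ((s , b) ∷ L) =
  ≤-trans (refine-potential p q (s , b) (process p q L)) (+-monoʳ-≤ (2 ^ b) (process-potential p q L))

starts-potential : ∀ {n} k h (C : List (Subset n)) → All (λ t → h ≤ ∣ t ∣) C →
                   potential (starts k C) ≤ length C * 2 ^ (k ∸ h)
starts-potential k h []      []          = z≤n
starts-potential {n} k h (t ∷ C) (h≤ ∷ large) =
  ≤-trans (prepend-potential t ⊥ k (starts k C) bound) (+-monoʳ-≤ _ (starts-potential k h C large))
  where
  open ≤-Reasoning
  bound : k + ∣ ⊥ {n} ∣ ≤ (k ∸ h) + ∣ t ∪ ⊥ ∣
  bound = begin
    k + ∣ ⊥ {n} ∣          ≡⟨ +∣⊥∣ k n ⟩
    k                      ≤⟨ m≤n+m∸n k h ⟩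
    h + (k ∸ h)            ≡⟨ +-comm h (k ∸ h) ⟩
    (k ∸ h) + h            ≤⟨ +-monoʳ-≤ (k ∸ h) h≤ ⟩
    (k ∸ h) + ∣ t ∣        ≡⟨ cong (λ u → (k ∸ h) + ∣ u ∣) (sym (∪-identityʳ t)) ⟩
    (k ∸ h) + ∣ t ∪ ⊥ ∣    ∎

-- Soundness and completeness on a graph

module _ (G : Graph) where

  private
    n = order G
    N = neighbours G

  adjacent⇒∈ : ∀ {u v} → adjacent G u v ≡ true → v ∈ N u
  adjacent⇒∈ {u} {v} eq = lookup⇒[]= v (N u) (trans (lookup∘tabulate (adjacent G u) v) eq)

  ∈⇒adjacent : ∀ {u v} → v ∈ N u → adjacent G u v ≡ true
  ∈⇒adjacent {u} {v} v∈ = trans (sym (lookup∘tabulate (adjacent G u) v)) ([]=⇒lookup v∈)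

  ⁅⁆⊆ : ∀ {v} {X : Subset n} → v ∈ X → ⁅ v ⁆ ⊆ X
  ⁅⁆⊆ {v} {X} v∈X x∈ = subst (_∈ X) (sym (x∈⁅y⁆⇒x≡y v x∈)) v∈X

  neighbours⊆cover : ∀ {X} → IsVertexCover G X → ∀ v → ¬ v ∈ X → N v ⊆ X
  neighbours⊆cover cover v v∉X {u} u∈ = [ (λ v∈X → contradiction v∈X v∉X) , id ]′ (cover v u (∈⇒adjacent u∈))

  Settled : Subset n → Vertex G → Set
  Settled s v = ⁅ v ⁆ ⊆ s ⊎ N v ⊆ s

  cover⇒settled : ∀ {X} → IsVertexCover G X → ∀ v → Settled X v
  cover⇒settled {X} cover v with v ∈? X
  ... | yes v∈X = inj₁ (⁅⁆⊆ v∈X)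
  ... | no  v∉X = inj₂ (neighbours⊆cover cover v v∉X)

  -- One settled endpoint covers an edge: either `u` lies in `s`, or `v` does as a neighbour of `u`.
  settled⇒cover : ∀ {s} → All (Settled s) (allFin n) → IsVertexCover G s
  settled⇒cover all u v adj = map-⊎ (λ i → i (x∈⁅x⁆ u)) (λ i → i (adjacent⇒∈ adj)) (All.lookup all (∈-allFin u))

  Sound : ℕ → List (Vertex G) → Candidate n → Set
  Sound k vs (s , b) = b + ∣ s ∣ ≡ k × All (Settled s) vs

  -- Candidates only grow, so a vertex once settled remains so; this is why a single sweep suffices.
  settled-mono : ∀ {s u vs} → s ⊆ u → All (Settled s) vs → All (Settled u) vs
  settled-mono s⊆u = All.map λ { (inj₁ i) → inj₁ (λ x∈ → s⊆u (i x∈)) ; (inj₂ i) → inj₂ (λ x∈ → s⊆u (i x∈)) }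

  prepend-sound : ∀ {k vs ws L} t c → (∀ {u} → t ⊆ u → All (Settled u) vs → All (Settled u) ws) →
                  Sound k vs c → All (Sound k ws) L → All (Sound k ws) (prepend t c L)
  prepend-sound t (s , b) extend-settled (eq , done) all with add t s b | add-spec t s b
  ... | just _  | refl , eq′ = (trans eq′ eq , extend-settled (p⊆p∪q s) (settled-mono (q⊆p∪q t s) done)) ∷ all
  ... | nothing | _          = all

  refine-sound : ∀ {k vs L} v c → Sound k vs c → All (Sound k (v ∷ vs)) L →
                 All (Sound k (v ∷ vs)) (refine ⁅ v ⁆ (N v) c L)
  refine-sound v c@(s , b) sound@(eq , done) all with add ⁅ v ⁆ s 0 in p-eq | add (N v) s 0 in q-eq
  ... | just _  | _       = (eq , inj₁ (free-add ⁅ v ⁆ s p-eq) ∷ done) ∷ all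
  ... | nothing | just _  = (eq , inj₂ (free-add (N v) s q-eq) ∷ done) ∷ all
  ... | nothing | nothing = prepend-sound ⁅ v ⁆ c (λ i → inj₁ i ∷_) sound
                              (prepend-sound (N v) c (λ i → inj₂ i ∷_) sound all)

  process-sound : ∀ {k vs} v {L} → All (Sound k vs) L → All (Sound k (v ∷ vs)) (process ⁅ v ⁆ (N v) L)
  process-sound v         []          = []
  process-sound v {c ∷ L} (sd ∷ all)  = refine-sound v c sd (process-sound v all)

  starts-sound : ∀ k C → All (Sound k []) (starts k C)
  starts-sound k []      = []
  starts-sound k (t ∷ C) = prepend-sound t (⊥ , k) (λ _ → id)
    (+∣⊥∣ k n , []) (starts-sound k C)

  search-sound : ∀ {k L} → All (Sound k []) L → ∀ vs → All (Sound k vs) (search G L vs)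
  search-sound all []       = all
  search-sound all (v ∷ vs) = process-sound v (search-sound all vs)

  search-promising : ∀ {X L} → IsVertexCover G X → Any (Promising X) L → ∀ vs → Any (Promising X) (search G L vs)
  search-promising cover any []       = any
  search-promising cover any (v ∷ vs) =
    process-promising ⁅ v ⁆ (N v) (cover⇒settled cover v) (search-promising cover any vs)

  search-potential : ∀ L vs → potential (search G L vs) ≤ potential L
  search-potential L []       = ≤-refl
  search-potential L (v ∷ vs) = ≤-trans (process-potential ⁅ v ⁆ (N v) (search G L vs)) (search-potential L vs)

  highSets-complete : ∀ {X} → IsVertexCover G X → ∀ i → Any (_⊆ X) (highSets G i)
  highSets-complete {X} cover i with any? (λ v → v ∈? highVertices G i ×-dec ¬? (v ∈? X))
  ... | yes (v , v∈H , v∉X) =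
    there (lose (∈-map⁺ N (∈-filter⁺ (T? ∘ exceeds i ∘ N) (∈-allFin v) v-high)) (neighbours⊆cover cover v v∉X))
    where
    v-high : Bool.T (exceeds i (N v))
    v-high = subst Bool.T (trans (sym ([]=⇒lookup v∈H)) (lookup∘tabulate (exceeds i ∘ N) v)) _
  ... | no none = here λ {v} v∈H → decidable-stable (v ∈? X) λ v∉X → none (v , v∈H , v∉X)

  startSets-complete : ∀ {X} → IsVertexCover G X → ∀ i → Any (_⊆ X) (startSets G i)
  startSets-complete cover zero    = here ⊥⊆
  startSets-complete cover (suc i) with add (highVertices G i) ⊥ i
  ... | just _  = startSets-complete cover i
  ... | nothing = highSets-complete cover i

  startSets-length : ∀ i → length (startSets G i) ≤ suc n
  startSets-length zero    = s≤s z≤n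
  startSets-length (suc i) with add (highVertices G i) ⊥ i
  ... | just _  = startSets-length i
  ... | nothing = s≤s (≤-trans (≤-reflexive (length-map N (filterᵇ (exceeds i ∘ N) (allFin n))))
                      (≤-trans (length-filter (T? ∘ exceeds i ∘ N) (allFin n)) (≤-reflexive (length-allFin n))))

  highVertices≡ : ∀ i → highVertices G i ≡ verticesOfDegree≥ G (suc i)
  highVertices≡ i = tabulate-cong (exceeds-spec i ∘ N)

  highSets-large : ∀ i → i < ∣ highVertices G i ∣ → All (λ t → suc i ≤ ∣ t ∣) (highSets G i)
  highSets-large i lt = lt ∷ All.map⁺ (All.map (λ {v} high → <ᵇ⇒< i (degree G v) (subst Bool.T (exceeds-spec i (N v)) high))
                                               (All.all-filter (T? ∘ exceeds i ∘ N) (allFin n)))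

  -- The descent cannot stop too low. If threshold `suc i` fails, then `h`, being attained, differs
  -- from it, so `h ≤ i`; if it succeeds, every set has more than `i` elements, hence at least `h`.
  startSets-large : ∀ {h} → AtLeast h VerticesOfDegree≥Itself G → ∀ i → h ≤ i →
                    All (λ t → h ≤ ∣ t ∣) (startSets G i)
  startSets-large attained zero    h≤ = ≤-trans h≤ z≤n ∷ []
  startSets-large {h} attained (suc i) h≤ with add (highVertices G i) ⊥ i | exceeds-spec i (highVertices G i)
  ... | just _  | eq = startSets-large attained i (s≤s⁻¹ (≤∧≢⇒< h≤ h≢1+i))
    where
    h≢1+i : h ≢ suc i
    h≢1+i refl = subst Bool.T (sym eq) (<⇒<ᵇ (subst (λ H → suc i ≤ ∣ H ∣) (sym (highVertices≡ i)) attained))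
  ... | nothing | eq = All.map (≤-trans h≤) (highSets-large i (<ᵇ⇒< i _ (subst Bool.T eq _)))

  result : ℕ → List (Candidate n)
  result k = search G (starts k (startSets G n)) (allFin n)

  search-width : ∀ {h} → AtLeast h VerticesOfDegree≥Itself G → ∀ k vs →
                 length (search G (starts k (startSets G n)) vs) ≤ suc n * 2 ^ (k ∸ h)
  search-width {h} attained k vs = begin
    length (search G L vs)     ≤⟨ length≤potential (search G L vs) ⟩
    potential (search G L vs)  ≤⟨ search-potential L vs ⟩
    potential L                ≤⟨ starts-potential k h C (startSets-large attained n h≤n) ⟩
    length C * 2 ^ (k ∸ h)     ≤⟨ *-monoˡ-≤ (2 ^ (k ∸ h)) (startSets-length n) ⟩
    suc n * 2 ^ (k ∸ h)        ∎
    where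
    open ≤-Reasoning
    C = startSets G n
    L = starts k C
    h≤n : h ≤ n
    h≤n = ≤-trans attained (∣p∣≤n (verticesOfDegree≥ G h))

answer : (G : Graph) → ℕ → Bool
answer G k = not (null (result G k))

result-sound : ∀ G k → All (Sound G k (allFin (order G))) (result G k)
result-sound G k = search-sound G (starts-sound G k (startSets G (order G))) (allFin (order G))

result-complete : ∀ G k {X} → IsVertexCover G X → ∣ X ∣ ≤ k → Any (Promising X) (result G k)
result-complete G k cover le =
  search-promising G cover (starts-promising le (startSets-complete G cover (order G))) (allFin (order G))

answer-correct : ∀ G k → Reflects (HasVertexCoverOfSize≤ G (ℤ.+ k)) (answer G k)
answer-correct G k with result G k | result-sound G k | result-complete G k
... | []          | _                  | complete =
  ofⁿ λ (X , cover , le) → ¬Any[] (complete cover (drop‿+≤+ le))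
... | (s , b) ∷ L | (eq , settled) ∷ _ | _        =
  ofʸ (s , settled⇒cover G settled , +≤+ (subst (∣ s ∣ ≤_) eq (m≤n+m _ b)))

¬negative-size : ∀ G k → ¬ HasVertexCoverOfSize≤ G -[1+ k ]
¬negative-size G k (_ , _ , ())

-- Running time

-- On negative integers one less than the absolute value: this is what the code holds behind the
-- sign, so dropping the sign computes it. There the truncated difference is 0, and any value bounds
-- it.
magnitude : ℤ → ℕ
magnitude (ℤ.+ m)  = m
magnitude -[1+ m ] = m

∸≤magnitude : ∀ k h → k ∸ h ≤ magnitude (ℤ.+ k ℤ.- ℤ.+ h)
∸≤magnitude k h with h ≤? k
... | yes h≤k = ≤-reflexive (cong magnitude (sym (trans (m-n≡m⊖n k h) (⊖-≥ h≤k))))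
... | no  h≰k = ≤-trans (≤-reflexive (m≤n⇒m∸n≡0 (≰⇒≥ h≰k))) z≤n

-- Abstract, because unfolding `hIndex` makes terms explode.

abstract
  excess : Graph × ℕ → ℕ
  excess (G , k) = k ∸ hIndex G

  excess≤magnitude : ∀ G k → excess (G , k) ≤ magnitude (ℤ.+ k ℤ.- ℤ.+ hIndex G)
  excess≤magnitude G k = ∸≤magnitude k (hIndex G)

  -- The input gives k in binary, but this bound makes writing it in unary affordable.

  k≤order+excess : ∀ G k → k ≤ order G + excess (G , k)
  k≤order+excess G k = ≤-trans (m≤n+m∸n k (hIndex G))
    (+-monoˡ-≤ (k ∸ hIndex G) (≤-trans (hIndex-attained G) (∣p∣≤n (verticesOfDegree≥ G (hIndex G)))))

  result-width : ∀ G k vs → length (search G (starts k (startSets G (order G))) vs)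
                            ≤ suc (order G) * 2 ^ excess (G , k)
  result-width G k = search-width G (hIndex-attained G) k

n<2^n : ∀ n → n < 2 ^ n
n<2^n zero    = ≤-refl
n<2^n (suc n) = +-mono-≤ (m^n>0 2 n) (≤-trans (n<2^n n) (m≤m+n _ 0))

cube : ∀ n → suc n * (suc n * suc n) ≡ suc n ^ 3
cube n = cong (suc n *_) (cong (suc n *_) (sym (*-identityʳ (suc n))))

abstract
  -- A common bound for all stages. The cube comes from finding the start sets and from the search;
  -- the square of `2 ^ m` from the quadratic conversion to unary, with k below `suc n * 2 ^ m`.
  budget : ℕ → ℕ → ℕ
  budget n m = suc n ^ 3 * (2 ^ m * 2 ^ m)

  cube≤budget : ∀ n m → suc n * (suc n * suc n) ≤ budget n m
  cube≤budget n m = ≤-trans (≤-reflexive (cube n)) (m≤m*n (suc n ^ 3) (2 ^ m * 2 ^ m) {{m*n≢0 (2 ^ m) (2 ^ m) {{m^n≢0 2 m}} {{m^n≢0 2 m}}}})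

  square≤budget : ∀ n m → suc n * suc n ≤ budget n m
  square≤budget n m = ≤-trans (m≤n*m (suc n * suc n) (suc n)) (cube≤budget n m)

  startSets≤budget : ∀ n m → n * suc (n * suc n) ≤ budget n m
  startSets≤budget n m = ≤-trans (*-mono-≤ (n≤1+n n) (+-monoˡ-≤ (n * suc n) (s≤s (z≤n {n})))) (cube≤budget n m)

  toUnary≤budget : ∀ n m k → k ≤ n + m → k * suc k ≤ budget n m
  toUnary≤budget n m k k≤ = begin
    k * suc k                                 ≤⟨ *-mono-≤ (≤-trans (n≤1+n k) k<[1+n]2^m) k<[1+n]2^m ⟩
    suc n * 2 ^ m * (suc n * 2 ^ m)           ≡⟨ shape (suc n) (2 ^ m) ⟩
    (suc n * suc n) * (2 ^ m * 2 ^ m)         ≤⟨ *-monoˡ-≤ (2 ^ m * 2 ^ m) (m≤n*m (suc n * suc n) (suc n)) ⟩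
    suc n * (suc n * suc n) * (2 ^ m * 2 ^ m) ≡⟨ cong (_* (2 ^ m * 2 ^ m)) (cube n) ⟩
    budget n m                                ∎
    where
    open ≤-Reasoning
    shape : ∀ u q → u * q * (u * q) ≡ (u * u) * (q * q)
    shape = solve-∀
    k<[1+n]2^m : k < suc n * 2 ^ m
    k<[1+n]2^m = begin
      suc k             ≤⟨ s≤s k≤ ⟩
      suc n + m         ≤⟨ +-monoʳ-≤ (suc n) (m≤n*m m (suc n)) ⟩
      suc n + suc n * m ≡⟨ *-suc (suc n) m ⟨
      suc n * suc m     ≤⟨ *-monoʳ-≤ (suc n) (n<2^n m) ⟩
      suc n * 2 ^ m     ∎

  search≤budget : ∀ n m → n * suc (suc n * 2 ^ m * suc n) ≤ budget n m
  search≤budget n m = begin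
    n * suc (suc n * 2 ^ m * suc n)           ≡⟨ *-suc n (suc n * 2 ^ m * suc n) ⟩
    n + n * (suc n * 2 ^ m * suc n)           ≤⟨ +-monoˡ-≤ _ (≤-trans (n≤1+n n) (m≤n*m (suc n) (suc n * 2 ^ m) {{m*n≢0 (suc n) (2 ^ m) {{_}} {{m^n≢0 2 m}}}})) ⟩
    suc n * (suc n * 2 ^ m * suc n)           ≡⟨ shape (suc n) (2 ^ m) ⟩
    suc n * (suc n * suc n) * 2 ^ m           ≤⟨ *-monoʳ-≤ (suc n * (suc n * suc n)) (m≤m*n (2 ^ m) (2 ^ m) {{m^n≢0 2 m}}) ⟩
    suc n * (suc n * suc n) * (2 ^ m * 2 ^ m) ≡⟨ cong (_* (2 ^ m * 2 ^ m)) (cube n) ⟩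
    budget n m                                ∎
    where
    open ≤-Reasoning
    shape : ∀ u q → u * (u * q * u) ≡ u * (u * u) * q
    shape = solve-∀

  -- The `suc` in the bound of `Realizes` is covered by doubling the cubic term, and `2 ≤ N` turns
  -- this 2 into the fourth factor `N`.
  budget≤ : ∀ n m {f N} → 2 ^ m * 2 ^ m ≤ f → suc n ≤ N → 2 ≤ N → suc (budget n m) ≤ f * N ^ 4
  budget≤ n m {f} {N} 4^m≤f u≤N 2≤N = begin
    suc (suc n ^ 3 * (2 ^ m * 2 ^ m))                         ≤⟨ +-monoˡ-≤ _ (*-mono-≤ (m^n>0 (suc n) 3) (*-mono-≤ (m^n>0 2 m) (m^n>0 2 m))) ⟩
    suc n ^ 3 * (2 ^ m * 2 ^ m) + suc n ^ 3 * (2 ^ m * 2 ^ m) ≡⟨ shape (suc n ^ 3) (2 ^ m * 2 ^ m) ⟩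
    2 ^ m * 2 ^ m * (2 * suc n ^ 3)                           ≤⟨ *-mono-≤ 4^m≤f (*-mono-≤ 2≤N (^-monoˡ-≤ 3 u≤N)) ⟩
    f * N ^ 4                                                 ∎
    where
    open ≤-Reasoning
    shape : ∀ a b → a * b + a * b ≡ b * (2 * a)
    shape = solve-∀

-- Assembling the decision program

testNonempty : Realizes {Σ ℕ (List ∘ Candidate)} (λ (_ , L) → encodeList encodeCandidate L)
                                                          (λ (_ , L) → encodeBool (not (null L))) (λ _ → 0)
testNonempty = by-decision (test x₀ yes return `true no return `nil)
  λ { (_ , []) → refl ; (_ , _ ∷ _) → refl }

decideNonnegative : Realizes {Graph × ℕ} (λ (G , k) → cons (encodeGraph G) (encodeℤ (ℤ.+ k)))
                                         (λ (G , k) → encodeBool (answer G k))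
                                         (λ (G , k) → budget (order G) (excess (G , k)))
decideNonnegative =
    call (`head x₀) (λ _ → refl)
      (weaken (λ (G , k) → ≤-trans (*-monoˡ-≤ (suc (order G)) (n≤1+n (order G))) (square≤budget (order G) (excess (G , k))))
      (reindex proj₁ preparation))
  ▸ call (`head x₀) (λ _ → refl)
      (weaken (λ (G , k) → startSets≤budget (order G) (excess (G , k))) (reindex proj₁ findStartSets))
  ▸ call (`tail (`tail (`tail (`tail x₀)))) (λ _ → refl)
      (weaken (λ (G , k) → toUnary≤budget (order G) (excess (G , k)) k (k≤order+excess G k)) (reindex proj₂ toUnary))
  ▸ call (`cons (`head (`tail x₀)) (`cons (`head (`head (`tail (`tail x₀)))) (`head x₀))) (λ _ → refl)
      (weaken (λ (G , k) → ≤-trans (*-monoˡ-≤ (suc (order G)) (startSets-length G (order G)))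
                                   (square≤budget (order G) (excess (G , k))))
      (reindex (λ (G , k) → order G , startSets G (order G) , k) findStarts))
  ▸ call (`cons (`tail (`head (`tail (`tail (`tail x₀))))) (`head x₀)) (λ _ → refl)
      (weaken (λ (G , k) → search≤budget (order G) (excess (G , k)))
      (reindex (λ (G , k) → record { graph      = G
                                   ; candidates = starts k (startSets G (order G))
                                   ; width      = suc (order G) * 2 ^ excess (G , k)
                                   ; narrow     = result-width G k })
               searching))
  ▸ call (`head x₀) (λ _ → refl)
      (weaken (λ _ → z≤n) (reindex (λ (G , k) → order G , result G k) testNonempty))
  ▸ set (`head x₀) (λ _ → refl)

choice : ∀ {A B : Set} {i o T i′ o′ T′} (e : Expr 1) →
         (∀ a → ⟦ e ⟧ (i a ∷ []) ≡ encodeBool false) → (∀ b → ⟦ e ⟧ (i′ b ∷ []) ≡ encodeBool true) →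
         Realizes {A} i o T → Realizes {B} i′ o′ T′ →
         Realizes {A ⊎ B} [ i , i′ ]′ [ o , o′ ]′ [ T , T′ ]′
choice e off on R S .cmd    = if e then S .cmd else R .cmd
choice e off on R S .factor = suc (cost e) + (R .factor + S .factor)
choice {T = T} e off on R S .run (inj₁ a) =
  let t , r , t≤ = R .run a
  in  suc (cost e) + t , if-false (off a) r ,
      ≤-trans (+-mono-≤ (m≤m*n (suc (cost e)) (suc (T a))) (≤-trans t≤ (*-monoˡ-≤ (suc (T a)) (m≤m+n (R .factor) (S .factor)))))
              (≤-reflexive (sym (*-distribʳ-+ (suc (T a)) (suc (cost e)) (R .factor + S .factor))))
choice {T′ = T} e off on R S .run (inj₂ a) =
  let t , r , t≤ = S .run a
  in  suc (cost e) + t , if-true (on a) r ,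
      ≤-trans (+-mono-≤ (m≤m*n (suc (cost e)) (suc (T a))) (≤-trans t≤ (*-monoˡ-≤ (suc (T a)) (m≤n+m (S .factor) (R .factor)))))
              (≤-reflexive (sym (*-distribʳ-+ (suc (T a)) (suc (cost e)) (R .factor + S .factor))))

abstract
  decider : Realizes {Graph × ℕ ⊎ Graph × ℕ}
              [ (λ (G , k) → cons (encodeGraph G) (encodeℤ (ℤ.+ k))) , (λ (G , k) → cons (encodeGraph G) (encodeℤ -[1+ k ])) ]′
              [ (λ (G , k) → encodeBool (answer G k)) , (λ _ → encodeBool false) ]′
              [ (λ (G , k) → budget (order G) (excess (G , k))) , (λ _ → 0) ]′
  decider = choice (`head (`tail x₀)) (λ _ → refl) (λ _ → refl) decideNonnegative (set `nil (λ _ → refl))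

-- The computable bound

ones : ℕ → ℕᵇ
ones zero    = ℕᵇ.zero
ones (suc d) = 1+[2 ones d ]

encode-ones : ∀ d → encodeℕᵇ (ones d) ≡ unary d
encode-ones zero    = refl
encode-ones (suc d) = cong (cons nil) (encode-ones d)

toℕ-ones : ∀ d → suc (ℕᵇ.toℕ (ones d)) ≡ 2 ^ d
toℕ-ones zero    = refl
toℕ-ones (suc d) = trans (shape (ℕᵇ.toℕ (ones d))) (cong (2 *_) (toℕ-ones d))
  where
  shape : ∀ m → suc (suc (2 * m)) ≡ 2 * suc m
  shape = solve-∀

-- The value is 2 ^ (2 m + 1) - 1 for m = magnitude z: in bijective binary, d
-- digits 1 denote 2 ^ d - 1, and their code is the unary code of d.

bound : ℤ → ℕ
bound z = ℕᵇ.toℕ (ones (suc (double (magnitude z))))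

bound-computable : Computable bound
bound-computable = program (computation .cmd) , λ z →
  let t , r , _ = computation .run z in t , _ , r , encode-bound z
  where
  encode-bound : ∀ z → unary (suc (double (magnitude z))) ≡ encodeℕ (bound z)
  encode-bound z = sym (trans (cong encodeℕᵇ (fromℕ-toℕ (ones d))) (encode-ones d))
    where d = suc (double (magnitude z))

  computation : Realizes encodeℤ (λ z → unary (suc (double (magnitude z)))) (λ z → magnitude z * suc (magnitude z))
  computation =
      set (`tail x₀) (λ { (ℤ.+ _) → refl ; -[1+ _ ] → refl })
    ▸ reindex magnitude toUnary
    ▸ weaken (λ z → m≤m*n (magnitude z) (suc (magnitude z))) (reindex magnitude doubling)
    ▸ set (`cons `nil x₀) (λ _ → refl)

bound-large : ∀ {m} z → m ≤ magnitude z → 2 ^ m * 2 ^ m ≤ bound z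
bound-large {m} z m≤ = s≤s⁻¹ (begin
  suc (2 ^ m * 2 ^ m)            ≤⟨ s≤s (*-mono-≤ (^-monoʳ-≤ 2 m≤) (^-monoʳ-≤ 2 m≤)) ⟩
  suc (2 ^ d * 2 ^ d)            ≡⟨ cong suc (sym (^-distribˡ-+-* 2 d d)) ⟩
  suc (2 ^ (d + d))              ≡⟨ cong (λ e → suc (2 ^ e)) (sym (trans (double≡2* d) (cong (d +_) (+-identityʳ d)))) ⟩
  -- The odd digit in `bound` makes up for the subtracted 1.
  suc (2 ^ double d)             ≤⟨ +-mono-≤ (m^n>0 2 (double d)) (m≤m+n _ 0) ⟩
  2 ^ suc (double d)             ≡⟨ toℕ-ones (suc (double d)) ⟨
  suc (bound z)                  ∎)
  where
  open ≤-Reasoning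
  d = magnitude z

-- Input size and the final estimate

length<size : ∀ {A : Set} (enc : A → Tree) xs → length xs < size (encodeList enc xs)
length<size enc []       = ≤-refl
length<size enc (x ∷ xs) = s≤s (≤-trans (length<size enc xs) (m≤n+m _ _))

order<size : ∀ G t → suc (order G) < size (cons (encodeGraph G) t)
order<size G t = s≤s (begin
  suc (order G)                 ≡⟨ cong suc (sym (length-tabulate rows)) ⟩
  suc (length (tabulate rows))  ≤⟨ length<size (encodeList encodeBool) (tabulate rows) ⟩
  size (encodeGraph G)          ≤⟨ m≤m+n (size (encodeGraph G)) (size t) ⟩
  size (encodeGraph G) + size t ∎)
  where
  open ≤-Reasoning
  rows : Vertex G → List Bool
  rows u = tabulate (adjacent G u)

-- `K ≤ 2 ^ K ≤ N ^ K`: the constant factor of the program goes into the exponent, so that `f` keeps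
-- its simple code.
absorb : ∀ K f N {t B} → 2 ≤ N → t ≤ K * B → B ≤ f * N ^ 4 → t ≤ f * N ^ (4 + K)
absorb K f N {t} {B} 2≤N t≤ B≤ = begin
  t                     ≤⟨ t≤ ⟩
  K * B                 ≤⟨ *-mono-≤ (≤-trans (<⇒≤ (n<2^n K)) (^-monoˡ-≤ K 2≤N)) B≤ ⟩
  N ^ K * (f * N ^ 4)   ≡⟨ shape (N ^ K) f (N ^ 4) ⟩
  f * (N ^ 4 * N ^ K)   ≡⟨ cong (f *_) (^-distribˡ-+-* N 4 K) ⟨
  f * N ^ (4 + K)       ∎
  where
  open ≤-Reasoning
  shape : ∀ a f b → a * (f * b) ≡ f * (b * a)
  shape = solve-∀

theorem1 : FixedParameterTractable VertexCoverAboveHIndex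
theorem1 = bound , bound-computable , program (decider .cmd) , 4 + decider .factor , decides
  where
  open ParameterizedProblem VertexCoverAboveHIndex using (encode; parameter)

  size≥2 : ∀ I → 2 ≤ size (encode I)
  size≥2 (G , k) = ≤-trans (s≤s (s≤s z≤n)) (order<size G (encodeℤ k))

  decides : program (decider .cmd) decides VertexCoverAboveHIndex
            within λ I → bound (parameter I) * size (encode I) ^ (4 + decider .factor)
  decides I@(G , ℤ.+ k) =
    let t , r , t≤ = decider .run (inj₁ (G , k))
    in  answer G k , t , (_ , r , refl) , answer-correct G k ,
        absorb (decider .factor) (bound (parameter I)) (size (encode I)) (size≥2 I) t≤
          (budget≤ (order G) (excess (G , k)) (bound-large (parameter I) (excess≤magnitude G k))
                   (<⇒≤ (order<size G (encodeℤ (ℤ.+ k)))) (size≥2 I))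
  decides I@(G , -[1+ k ]) =
    let t , r , t≤ = decider .run (inj₂ (G , k))
    in  false , t , (_ , r , refl) , ofⁿ (¬negative-size G k) ,
        absorb (decider .factor) (bound (parameter I)) (size (encode I)) (size≥2 I) t≤
          -- The rejecting branch takes constant time, so `1 ≤ f * N ^ 4` is enough; `bound-large`
          -- at exponent 0 yields `1 ≤ f`.
          (*-mono-≤ (bound-large (parameter I) (z≤n {magnitude (parameter I)}))
                    (m^n>0 (size (encode I)) {{>-nonZero (<⇒≤ (size≥2 I))}} 4))
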